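{- Let $n,k,s$ be positive integers and let $p_0\geq p_1\geq\cdots\geq p_s>0$ be arbitrary real numbers, $\vec{p}=(p_0,\ldots,p_s)$. Set $$d_{\vec{p}}=\max_{1\leq i\leq s}\frac{i(p_0+\cdots+p_s)}{p_1+\cdots+p_i}.$$ If $n\geq\max\{(s+1)k,\ \lceil d_{\vec{p}}\rceil k\}$, then $$f_{\vec{p}}(n,k,s)=(p_1+\cdots+p_s)\binom{n}{k}.$$
   Context: $[n]=\{1,\ldots,n\}$ and $\binom{[n]}{k}$ is the collection of all $k$-element subsets of $[n]$. For families $\mathcal{A}_1,\ldots,\mathcal{A}_m\subseteq 2^{[n]}$ the rainbow matching number $\nu(\mathcal{A}_1,\ldots,\mathcal{A}_m)$ is the maximum integer $r$ such that there are indices $1\leq i_1<\cdots<i_r\leq m$ and pairwise disjoint sets $A_{i_1}\in\mathcal{A}_{i_1},\ldots,A_{i_r}\in\mathcal{A}_{i_r}$. A sequence of $s+1$ families $\mathcal{B}_0,\mathcal{B}_1,\ldots,\mathcal{B}_s\subseteq 2^{[n]}$ is called overlapping if $\nu(\mathcal{B}_0,\ldots,\mathcal{B}_s)\leq s$, i.e. one cannot choose pairwise disjoint sets $B_i\in\mathcal{B}_i$, $i=0,\ldots,s$. For real constants $p_0\geq p_1\geq\cdots\geq p_s>0$, $\vec{p}=(p_0,\ldots,p_s)$ and $n\geq (s+1)k$, define $$f_{\vec{p}}(n,k,s)=\max\left\{\sum_{i=0}^s p_i|\mathcal{B}_i| : \mathcal{B}_0\subseteq\mathcal{B}_1\subseteq\cdots\subseteq\mathcal{B}_s\subseteq\binom{[n]}{k}\text{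 are overlapping}\right\}$$ (families may be empty and may coincide). -}

module Defs where

open import Algebra.Bundles.Raw using (RawMonoid)
import Algebra.Definitions.RawMonoid as RawMonoidOps
open import Data.Fin.Base as Fin using (Fin; zero; suc; toℕ; inject≤; fromℕ)
open import Data.Fin.Properties using (toℕ<n; ≤fromℕ)
open import Data.Fin.Subset using (Subset; Empty; _∩_; ∣_∣)
open import Data.Integer.Base as ℤ using (ℤ; +_)
open import Data.List.Base using (List; length)
open import Data.List.Membership.Propositional using (_∈_)
open import Data.List.Relation.Binary.Subset.Propositional using (_⊆_)
open import Data.List.Relation.Unary.Unique.Propositional using (Unique)
open import Data.Nat.Base as ℕ using (ℕ; zero; suc; NonZero)
import Data.Nat.Properties as ℕ
open import Data.Product.Base using (∃; _×_; _,_; proj₁; proj₂)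
open import Data.Rational.Base as ℚ using (ℚ; 0ℚ; 1ℚ; ½)
import Data.Rational.Properties as ℚ
open import Data.Rational.Solver using (module +-*-Solver)
open import Data.Sum.Base using (inj₁; inj₂)
open import Data.Vec.Functional using (Vector)
open import Level using (0ℓ)
open import Relation.Binary.Definitions using (Antitonic₁)
open import Relation.Binary.PropositionalEquality
  using (_≡_; _≢_; refl; sym; trans; cong; cong₂; subst; module ≡-Reasoning)

------------------------------------------------------------------------
-- Rational estimates

swap-sub : ∀ p q → ℚ.- (p ℚ.- q) ≡ q ℚ.- p
swap-sub = solve 2 (λ p q → :- (p :- q) := q :- p) refl
  where open +-*-Solver

cancel-sub : ∀ p q → (p ℚ.- q) ℚ.+ q ≡ p
cancel-sub = solve 2 (λ p q → (p :- q) :+ q := p) refl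
  where open +-*-Solver

p≤∣p∣ : ∀ p → p ℚ.≤ ℚ.∣ p ∣
p≤∣p∣ p with ℚ.≤-total 0ℚ p
... | inj₁ 0≤p = ℚ.≤-reflexive (sym (ℚ.0≤p⇒∣p∣≡p 0≤p))
... | inj₂ p≤0 = ℚ.≤-trans p≤0 (ℚ.0≤∣p∣ p)

∣-∣-comm : ∀ p q → ℚ.∣ p ℚ.- q ∣ ≡ ℚ.∣ q ℚ.- p ∣
∣-∣-comm p q =
  trans (sym (ℚ.∣-p∣≡∣p∣ (p ℚ.- q))) (cong ℚ.∣_∣ (swap-sub p q))

∣-∣≤⇒≤+ : ∀ p q {ε} → ℚ.∣ p ℚ.- q ∣ ℚ.≤ ε → p ℚ.≤ ε ℚ.+ q
∣-∣≤⇒≤+ p q {ε} h = begin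
  p                 ≡⟨ cancel-sub p q ⟨
  (p ℚ.- q) ℚ.+ q   ≤⟨ ℚ.+-monoˡ-≤ q (ℚ.≤-trans (p≤∣p∣ (p ℚ.- q)) h) ⟩
  ε ℚ.+ q           ∎
  where open ℚ.≤-Reasoning

≤+⇒-≤ : ∀ p q ε → p ℚ.≤ ε ℚ.+ q → p ℚ.- q ℚ.≤ ε
≤+⇒-≤ p q ε h = begin
  p ℚ.- q           ≤⟨ ℚ.+-monoˡ-≤ (ℚ.- q) h ⟩
  (ε ℚ.+ q) ℚ.- q   ≡⟨ solve 2 (λ e q → (e :+ q) :- q := e) refl ε q ⟩
  ε                 ∎
  where
  open ℚ.≤-Reasoning
  open +-*-Solver

≤+⇒∣-∣≤ : ∀ p q ε → p ℚ.≤ ε ℚ.+ q → q ℚ.≤ ε ℚ.+ p → ℚ.∣ p ℚ.- q ∣ ℚ.≤ ε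
≤+⇒∣-∣≤ p q ε h k with ℚ.∣p∣≡p∨∣p∣≡-p (p ℚ.- q)
... | inj₁ e = subst (ℚ._≤ ε) (sym e) (≤+⇒-≤ p q ε h)
... | inj₂ e = subst (ℚ._≤ ε) (sym (trans e (swap-sub p q))) (≤+⇒-≤ q p ε k)

⊔-close : ∀ a b c d {ε} → ℚ.∣ a ℚ.- b ∣ ℚ.≤ ε → ℚ.∣ c ℚ.- d ∣ ℚ.≤ ε →
          ℚ.∣ (a ℚ.⊔ c) ℚ.- (b ℚ.⊔ d) ∣ ℚ.≤ ε
⊔-close a b c d {ε} h k = ≤+⇒∣-∣≤ (a ℚ.⊔ c) (b ℚ.⊔ d) ε
  (half a b c d (∣-∣≤⇒≤+ a b h) (∣-∣≤⇒≤+ c d k))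
  (half b a d c (∣-∣≤⇒≤+ b a (subst (ℚ._≤ ε) (∣-∣-comm a b) h))
                (∣-∣≤⇒≤+ d c (subst (ℚ._≤ ε) (∣-∣-comm c d) k)))
  where
  half : ∀ a b c d → a ℚ.≤ ε ℚ.+ b → c ℚ.≤ ε ℚ.+ d →
         a ℚ.⊔ c ℚ.≤ ε ℚ.+ (b ℚ.⊔ d)
  half a b c d u v = ℚ.⊔-lub
    (ℚ.≤-trans u (ℚ.+-monoʳ-≤ ε (ℚ.p≤p⊔q b d)))
    (ℚ.≤-trans v (ℚ.+-monoʳ-≤ ε (ℚ.p≤q⊔p b d)))

0<½* : ∀ {ε} → 0ℚ ℚ.< ε → 0ℚ ℚ.< ½ ℚ.* ε
0<½* {ε} ε>0 = ℚ.positive⁻¹ (½ ℚ.* ε)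
  where instance
    _ = ℚ.positive ε>0
    _ = ℚ.pos*pos⇒pos ½ ε

0<* : ∀ {p q} → 0ℚ ℚ.< p → 0ℚ ℚ.< q → 0ℚ ℚ.< p ℚ.* q
0<* {p} {q} p>0 q>0 = ℚ.positive⁻¹ (p ℚ.* q)
  where instance
    _ = ℚ.positive p>0
    _ = ℚ.positive q>0
    _ = ℚ.pos*pos⇒pos p q

½+½ : ∀ ε → ½ ℚ.* ε ℚ.+ ½ ℚ.* ε ≡ ε
½+½ ε = trans (sym (ℚ.*-distribʳ-+ ε ½ ½)) (ℚ.*-identityˡ ε)

inv : ∀ {p} → 0ℚ ℚ.< p → ℚ
inv {p} p>0 = (ℚ.1/ p) {{ℚ.>-nonZero p>0}}

inv>0 : ∀ {p} (p>0 : 0ℚ ℚ.< p) → 0ℚ ℚ.< inv p>0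
inv>0 {p} p>0 = ℚ.positive⁻¹ (inv p>0)
  {{ℚ.1/pos⇒pos p {{ℚ.positive p>0}}}}

*-inv : ∀ {p} (p>0 : 0ℚ ℚ.< p) → p ℚ.* inv p>0 ≡ 1ℚ
*-inv {p} p>0 = ℚ.*-inverseʳ p {{ℚ.>-nonZero p>0}}

*-mono : ∀ a b c d → 0ℚ ℚ.≤ c → 0ℚ ℚ.≤ b → a ℚ.≤ b → c ℚ.≤ d →
         a ℚ.* c ℚ.≤ b ℚ.* d
*-mono a b c d 0≤c 0≤b a≤b c≤d = ℚ.≤-trans
  (ℚ.*-monoʳ-≤-nonNeg c {{ℚ.nonNegative 0≤c}} a≤b)
  (ℚ.*-monoˡ-≤-nonNeg b {{ℚ.nonNegative 0≤b}} c≤d)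

------------------------------------------------------------------------
-- Real numbers, as Cauchy sequences of rationals

record ℝ : Set where
  constructor mkℝ
  field
    seq    : ℕ → ℚ
    cauchy : ∀ ε → 0ℚ ℚ.< ε → ∃ λ N → ∀ m n → N ℕ.≤ m → N ℕ.≤ n →
             ℚ.∣ seq m ℚ.- seq n ∣ ℚ.≤ ε

open ℝ public

infix  4 _≈_ _≤_ _<_
infixl 6 _+_ _⊔_
infixl 7 _*_

_≈_ : ℝ → ℝ → Set
x ≈ y = ∀ ε → 0ℚ ℚ.< ε → ∃ λ N → ∀ n → N ℕ.≤ n →
        ℚ.∣ seq x n ℚ.- seq y n ∣ ℚ.≤ ε

_≤_ : ℝ → ℝ → Set
x ≤ y = ∀ ε → 0ℚ ℚ.< ε → ∃ λ N → ∀ n → N ℕ.≤ n → seq x n ℚ.≤ seq y n ℚ.+ ε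

_<_ : ℝ → ℝ → Set
x < y = ∃ λ ε → 0ℚ ℚ.< ε × ∃ λ N → ∀ n → N ℕ.≤ n → seq x n ℚ.+ ε ℚ.≤ seq y n

fromℚ : ℚ → ℝ
fromℚ q = mkℝ (λ _ → q) λ ε ε>0 → 0 , λ _ _ _ _ →
  ℚ.≤-trans (ℚ.≤-reflexive (cong ℚ.∣_∣ (ℚ.+-inverseʳ q))) (ℚ.<⇒≤ ε>0)

fromℤ : ℤ → ℝ
fromℤ i = fromℚ (i ℚ./ 1)

ofℕ : ℕ → ℝ
ofℕ n = fromℤ (+ n)

0ℝ : ℝ
0ℝ = fromℚ 0ℚ

_+_ : ℝ → ℝ → ℝ
x + y = mkℝ (λ n → seq x n ℚ.+ seq y n) λ ε ε>0 →
  let (M , hx) = cauchy x (½ ℚ.* ε) (0<½* ε>0)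
      (N , hy) = cauchy y (½ ℚ.* ε) (0<½* ε>0)
  in M ℕ.⊔ N , λ m n p q → let open ℚ.≤-Reasoning in begin
    ℚ.∣ (seq x m ℚ.+ seq y m) ℚ.- (seq x n ℚ.+ seq y n) ∣
      ≡⟨ cong ℚ.∣_∣ (regroup (seq x m) (seq y m) (seq x n) (seq y n)) ⟩
    ℚ.∣ (seq x m ℚ.- seq x n) ℚ.+ (seq y m ℚ.- seq y n) ∣
      ≤⟨ ℚ.∣p+q∣≤∣p∣+∣q∣ (seq x m ℚ.- seq x n) (seq y m ℚ.- seq y n) ⟩
    ℚ.∣ seq x m ℚ.- seq x n ∣ ℚ.+ ℚ.∣ seq y m ℚ.- seq y n ∣
      ≤⟨ ℚ.+-mono-≤ (hx m n (ℕ.m⊔n≤o⇒m≤o M N p) (ℕ.m⊔n≤o⇒m≤o M N q))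
                    (hy m n (ℕ.m⊔n≤o⇒n≤o M N p) (ℕ.m⊔n≤o⇒n≤o M N q)) ⟩
    ½ ℚ.* ε ℚ.+ ½ ℚ.* ε
      ≡⟨ ½+½ ε ⟩
    ε ∎
  where
  regroup : ∀ a b c d → (a ℚ.+ b) ℚ.- (c ℚ.+ d) ≡ (a ℚ.- c) ℚ.+ (b ℚ.- d)
  regroup = solve 4 (λ a b c d → (a :+ b) :- (c :+ d) := (a :- c) :+ (b :- d)) refl
    where open +-*-Solver

_⊔_ : ℝ → ℝ → ℝ
x ⊔ y = mkℝ (λ n → seq x n ℚ.⊔ seq y n) λ ε ε>0 →
  let (M , hx) = cauchy x ε ε>0
      (N , hy) = cauchy y ε ε>0
  in M ℕ.⊔ N , λ m n p q → ⊔-close (seq x m) (seq x n) (seq y m) (seq y n)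
       (hx m n (ℕ.m⊔n≤o⇒m≤o M N p) (ℕ.m⊔n≤o⇒m≤o M N q))
       (hy m n (ℕ.m⊔n≤o⇒n≤o M N p) (ℕ.m⊔n≤o⇒n≤o M N q))

bounded : ∀ x → ∃ λ B → 0ℚ ℚ.< B × ∃ λ N → ∀ n → N ℕ.≤ n → ℚ.∣ seq x n ∣ ℚ.≤ B
bounded x with cauchy x 1ℚ (ℚ.positive⁻¹ 1ℚ)
... | N , h = 1ℚ ℚ.+ ℚ.∣ seq x N ∣
            , ℚ.+-mono-<-≤ (ℚ.positive⁻¹ 1ℚ) (ℚ.0≤∣p∣ (seq x N))
            , N , λ n N≤n → let open ℚ.≤-Reasoning in begin
  ℚ.∣ seq x n ∣
    ≡⟨ cong ℚ.∣_∣ (cancel-sub (seq x n) (seq x N)) ⟨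
  ℚ.∣ (seq x n ℚ.- seq x N) ℚ.+ seq x N ∣
    ≤⟨ ℚ.∣p+q∣≤∣p∣+∣q∣ (seq x n ℚ.- seq x N) (seq x N) ⟩
  ℚ.∣ seq x n ℚ.- seq x N ∣ ℚ.+ ℚ.∣ seq x N ∣
    ≤⟨ ℚ.+-monoˡ-≤ ℚ.∣ seq x N ∣ (h n N N≤n ℕ.≤-refl) ⟩
  1ℚ ℚ.+ ℚ.∣ seq x N ∣ ∎

_*_ : ℝ → ℝ → ℝ
x * y = mkℝ (λ n → seq x n ℚ.* seq y n) *-cauchy
  where
  split : ∀ a b c d → (a ℚ.* b) ℚ.- (c ℚ.* d) ≡ a ℚ.* (b ℚ.- d) ℚ.+ (a ℚ.- c) ℚ.* d
  split = solve 4 (λ a b c d → (a :* b) :- (c :* d) := a :* (b :- d) :+ (a :- c) :* d) refl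
    where open +-*-Solver

  *-cauchy : ∀ ε → 0ℚ ℚ.< ε → ∃ λ N → ∀ m n → N ℕ.≤ m → N ℕ.≤ n →
             ℚ.∣ (seq x m ℚ.* seq y m) ℚ.- (seq x n ℚ.* seq y n) ∣ ℚ.≤ ε
  *-cauchy ε ε>0 = (K ℕ.⊔ L) ℕ.⊔ (M ℕ.⊔ N) , λ m n p q →
    let p₁ = ℕ.m⊔n≤o⇒m≤o (K ℕ.⊔ L) (M ℕ.⊔ N) p
        p₂ = ℕ.m⊔n≤o⇒n≤o (K ℕ.⊔ L) (M ℕ.⊔ N) p
        q₁ = ℕ.m⊔n≤o⇒m≤o (K ℕ.⊔ L) (M ℕ.⊔ N) q
        q₂ = ℕ.m⊔n≤o⇒n≤o (K ℕ.⊔ L) (M ℕ.⊔ N) q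
        xm = seq x m; xn = seq x n; ym = seq y m; yn = seq y n
        open ℚ.≤-Reasoning
    in begin
    ℚ.∣ (xm ℚ.* ym) ℚ.- (xn ℚ.* yn) ∣
      ≡⟨ cong ℚ.∣_∣ (split xm ym xn yn) ⟩
    ℚ.∣ xm ℚ.* (ym ℚ.- yn) ℚ.+ (xm ℚ.- xn) ℚ.* yn ∣
      ≤⟨ ℚ.∣p+q∣≤∣p∣+∣q∣ (xm ℚ.* (ym ℚ.- yn)) ((xm ℚ.- xn) ℚ.* yn) ⟩
    ℚ.∣ xm ℚ.* (ym ℚ.- yn) ∣ ℚ.+ ℚ.∣ (xm ℚ.- xn) ℚ.* yn ∣
      ≡⟨ cong₂ ℚ._+_ (ℚ.∣p*q∣≡∣p∣*∣q∣ xm (ym ℚ.- yn)) (ℚ.∣p*q∣≡∣p∣*∣q∣ (xm ℚ.- xn) yn) ⟩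
    ℚ.∣ xm ∣ ℚ.* ℚ.∣ ym ℚ.- yn ∣ ℚ.+ ℚ.∣ xm ℚ.- xn ∣ ℚ.* ℚ.∣ yn ∣
      ≤⟨ ℚ.+-mono-≤
           (*-mono ℚ.∣ xm ∣ A ℚ.∣ ym ℚ.- yn ∣ δ (ℚ.0≤∣p∣ (ym ℚ.- yn)) (ℚ.<⇒≤ A>0)
                   (hA m (ℕ.m⊔n≤o⇒m≤o K L p₁))
                   (hy m n (ℕ.m⊔n≤o⇒n≤o M N p₂) (ℕ.m⊔n≤o⇒n≤o M N q₂)))
           (*-mono ℚ.∣ xm ℚ.- xn ∣ δ ℚ.∣ yn ∣ B (ℚ.0≤∣p∣ yn) (ℚ.<⇒≤ δ>0)
                   (hx m n (ℕ.m⊔n≤o⇒m≤o M N p₂) (ℕ.m⊔n≤o⇒m≤o M N q₂))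
                   (hB n (ℕ.m⊔n≤o⇒n≤o K L q₁))) ⟩
    A ℚ.* δ ℚ.+ δ ℚ.* B
      ≡⟨ collect A B ε (inv S>0) ⟩
    ε ℚ.* ((A ℚ.+ B) ℚ.* inv S>0)
      ≡⟨ cong (ε ℚ.*_) (*-inv S>0) ⟩
    ε ℚ.* 1ℚ
      ≡⟨ ℚ.*-identityʳ ε ⟩
    ε ∎
    where
    A   = proj₁ (bounded x)
    A>0 = proj₁ (proj₂ (bounded x))
    K   = proj₁ (proj₂ (proj₂ (bounded x)))
    hA  = proj₂ (proj₂ (proj₂ (bounded x)))
    B   = proj₁ (bounded y)
    B>0 = proj₁ (proj₂ (bounded y))
    L   = proj₁ (proj₂ (proj₂ (bounded y)))
    hB  = proj₂ (proj₂ (proj₂ (bounded y)))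
    S>0 : 0ℚ ℚ.< A ℚ.+ B
    S>0 = ℚ.+-mono-< A>0 B>0
    δ : ℚ
    δ = ε ℚ.* inv S>0
    δ>0 : 0ℚ ℚ.< δ
    δ>0 = 0<* ε>0 (inv>0 S>0)
    M   = proj₁ (cauchy x δ δ>0)
    hx  = proj₂ (cauchy x δ δ>0)
    N   = proj₁ (cauchy y δ δ>0)
    hy  = proj₂ (cauchy y δ δ>0)
    collect : ∀ a b e i → a ℚ.* (e ℚ.* i) ℚ.+ (e ℚ.* i) ℚ.* b ≡ e ℚ.* ((a ℚ.+ b) ℚ.* i)
    collect = solve 4 (λ a b e i → a :* (e :* i) :+ (e :* i) :* b := e :* ((a :+ b) :* i)) refl
      where open +-*-Solver

-- A witness of 0 < y supplies a rational c with 0 < c ≤ yₙ for all large n, so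
-- that replacing yₙ by yₙ ⊔ c changes only finitely many terms.
_⁻¹⟨_⟩ : ∀ y → 0ℝ < y → ℝ
y ⁻¹⟨ c , c>0 , _ ⟩ = mkℝ (λ n → inv (pos n)) inv-cauchy
  where
  den : ℕ → ℚ
  den n = seq y n ℚ.⊔ c

  pos : ∀ n → 0ℚ ℚ.< den n
  pos n = ℚ.<-≤-trans c>0 (ℚ.p≤q⊔p (seq y n) c)

  inv≤ : ∀ n → inv (pos n) ℚ.≤ inv c>0
  inv≤ n = begin
    inv (pos n)                             ≡⟨ ℚ.*-identityʳ (inv (pos n)) ⟨
    inv (pos n) ℚ.* 1ℚ                      ≡⟨ cong (inv (pos n) ℚ.*_) (*-inv c>0) ⟨
    inv (pos n) ℚ.* (c ℚ.* inv c>0)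
      ≤⟨ ℚ.*-monoˡ-≤-nonNeg (inv (pos n)) {{ℚ.nonNegative (ℚ.<⇒≤ (inv>0 (pos n)))}}
           (ℚ.*-monoʳ-≤-nonNeg (inv c>0) {{ℚ.nonNegative (ℚ.<⇒≤ (inv>0 c>0))}}
             (ℚ.p≤q⊔p (seq y n) c)) ⟩
    inv (pos n) ℚ.* (den n ℚ.* inv c>0)
      ≡⟨ solve 3 (λ i d j → i :* (d :* j) := (d :* i) :* j) refl
           (inv (pos n)) (den n) (inv c>0) ⟩
    (den n ℚ.* inv (pos n)) ℚ.* inv c>0     ≡⟨ cong (ℚ._* inv c>0) (*-inv (pos n)) ⟩
    1ℚ ℚ.* inv c>0                          ≡⟨ ℚ.*-identityˡ (inv c>0) ⟩
    inv c>0                                 ∎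
    where
    open ℚ.≤-Reasoning
    open +-*-Solver

  inv-diff : ∀ m n → inv (pos m) ℚ.- inv (pos n) ≡
             (den n ℚ.- den m) ℚ.* (inv (pos m) ℚ.* inv (pos n))
  inv-diff m n = sym (begin-equality
    (den n ℚ.- den m) ℚ.* (i ℚ.* j)
      ≡⟨ solve 4 (λ a b i j → (b :- a) :* (i :* j) := (b :* j) :* i :- (a :* i) :* j) refl
           (den m) (den n) i j ⟩
    (den n ℚ.* j) ℚ.* i ℚ.- (den m ℚ.* i) ℚ.* j
      ≡⟨ cong₂ (λ u v → u ℚ.* i ℚ.- v ℚ.* j) (*-inv (pos n)) (*-inv (pos m)) ⟩
    1ℚ ℚ.* i ℚ.- 1ℚ ℚ.* j
      ≡⟨ cong₂ ℚ._-_ (ℚ.*-identityˡ i) (ℚ.*-identityˡ j) ⟩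
    i ℚ.- j ∎)
    where
    open ℚ.≤-Reasoning
    open +-*-Solver
    i = inv (pos m)
    j = inv (pos n)

  inv-cauchy : ∀ ε → 0ℚ ℚ.< ε → ∃ λ N → ∀ m n → N ℕ.≤ m → N ℕ.≤ n →
               ℚ.∣ inv (pos m) ℚ.- inv (pos n) ∣ ℚ.≤ ε
  inv-cauchy ε ε>0 = N , λ m n p q →
    let i = inv (pos m); j = inv (pos n); i₀ = inv c>0
        j≥0 = ℚ.<⇒≤ (inv>0 (pos n))
        open ℚ.≤-Reasoning
    in begin
    ℚ.∣ i ℚ.- j ∣
      ≡⟨ cong ℚ.∣_∣ (inv-diff m n) ⟩
    ℚ.∣ (den n ℚ.- den m) ℚ.* (i ℚ.* j) ∣
      ≡⟨ ℚ.∣p*q∣≡∣p∣*∣q∣ (den n ℚ.- den m) (i ℚ.* j) ⟩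
    ℚ.∣ den n ℚ.- den m ∣ ℚ.* ℚ.∣ i ℚ.* j ∣
      ≡⟨ cong (ℚ.∣ den n ℚ.- den m ∣ ℚ.*_)
           (ℚ.0≤p⇒∣p∣≡p (ℚ.<⇒≤ (0<* (inv>0 (pos m)) (inv>0 (pos n))))) ⟩
    ℚ.∣ den n ℚ.- den m ∣ ℚ.* (i ℚ.* j)
      ≤⟨ *-mono ℚ.∣ den n ℚ.- den m ∣ (ε ℚ.* (c ℚ.* c)) (i ℚ.* j) (i₀ ℚ.* i₀)
                (ℚ.<⇒≤ (0<* (inv>0 (pos m)) (inv>0 (pos n))))
                (ℚ.<⇒≤ (0<* ε>0 (0<* c>0 c>0)))
                (⊔-close (seq y n) (seq y m) c c (h n m q p) c-close)
                (*-mono i i₀ j i₀ j≥0 (ℚ.<⇒≤ (inv>0 c>0)) (inv≤ m) (inv≤ n)) ⟩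
    (ε ℚ.* (c ℚ.* c)) ℚ.* (i₀ ℚ.* i₀)
      ≡⟨ regroup ε c i₀ ⟩
    ε ℚ.* ((c ℚ.* i₀) ℚ.* (c ℚ.* i₀))
      ≡⟨ cong (λ u → ε ℚ.* (u ℚ.* u)) (*-inv c>0) ⟩
    ε ℚ.* 1ℚ
      ≡⟨ ℚ.*-identityʳ ε ⟩
    ε ∎
    where
    N = proj₁ (cauchy y (ε ℚ.* (c ℚ.* c)) (0<* ε>0 (0<* c>0 c>0)))
    h = proj₂ (cauchy y (ε ℚ.* (c ℚ.* c)) (0<* ε>0 (0<* c>0 c>0)))
    c-close : ℚ.∣ c ℚ.- c ∣ ℚ.≤ ε ℚ.* (c ℚ.* c)
    c-close = ℚ.≤-trans (ℚ.≤-reflexive (cong ℚ.∣_∣ (ℚ.+-inverseʳ c)))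
                        (ℚ.<⇒≤ (0<* ε>0 (0<* c>0 c>0)))
    regroup : ∀ e c i → (e ℚ.* (c ℚ.* c)) ℚ.* (i ℚ.* i) ≡ e ℚ.* ((c ℚ.* i) ℚ.* (c ℚ.* i))
    regroup = solve 3 (λ e c i → (e :* (c :* c)) :* (i :* i) := e :* ((c :* i) :* (c :* i))) refl
      where open +-*-Solver

⁻¹-inverseʳ : ∀ y (y>0 : 0ℝ < y) → y * y ⁻¹⟨ y>0 ⟩ ≈ fromℚ 1ℚ
⁻¹-inverseʳ y (c , c>0 , N , h) ε ε>0 = N , λ n N≤n →
  ℚ.≤-trans (ℚ.≤-reflexive (cong ℚ.∣_∣ (vanish n N≤n))) (ℚ.<⇒≤ ε>0)
  where
  yⁱ : ℕ → ℚ
  yⁱ = seq (y ⁻¹⟨ c , c>0 , N , h ⟩)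

  vanish : ∀ n → N ℕ.≤ n → seq y n ℚ.* yⁱ n ℚ.- 1ℚ ≡ 0ℚ
  vanish n N≤n = begin
    seq y n ℚ.* yⁱ n ℚ.- 1ℚ
      ≡⟨ cong (λ u → u ℚ.* yⁱ n ℚ.- 1ℚ) (ℚ.p≥q⇒p⊔q≡p c≤yₙ) ⟨
    (seq y n ℚ.⊔ c) ℚ.* yⁱ n ℚ.- 1ℚ
      ≡⟨ cong (ℚ._- 1ℚ) (*-inv (ℚ.<-≤-trans c>0 (ℚ.p≤q⊔p (seq y n) c))) ⟩
    1ℚ ℚ.- 1ℚ
      ≡⟨⟩
    0ℚ ∎
    where
    open ≡-Reasoning
    c≤yₙ : c ℚ.≤ seq y n
    c≤yₙ = ℚ.≤-trans (ℚ.≤-reflexive (sym (ℚ.+-identityˡ c))) (h n N≤n)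

infixl 7 _/_⟨_⟩

_/_⟨_⟩ : (x y : ℝ) → 0ℝ < y → ℝ
x / y ⟨ y>0 ⟩ = x * (y ⁻¹⟨ y>0 ⟩)

+-0-rawMonoid : RawMonoid 0ℓ 0ℓ
+-0-rawMonoid = record { Carrier = ℝ ; _≈_ = _≈_ ; _∙_ = _+_ ; ε = 0ℝ }

open RawMonoidOps +-0-rawMonoid public using (sum)

maximum : ∀ {m} .{{_ : NonZero m}} → Vector ℝ m → ℝ
maximum {suc zero}    v = v zero
maximum {suc (suc m)} v = v zero ⊔ maximum (λ i → v (suc i))

-- ⌈x⌉ = c, as a relation: constructively ⌈_⌉ is not a function on ℝ.
IsCeiling : ℝ → ℤ → Set
IsCeiling x c = x ≤ fromℤ c × (∀ m → x ≤ fromℤ m → c ℤ.≤ m)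

record IsMaximum {I : Set} (value : I → ℝ) (v : ℝ) : Set where
  field
    attained   : ∃ λ i → value i ≈ v
    upperBound : ∀ i → value i ≤ v

0<-≤-trans : ∀ {x y} → 0ℝ < x → x ≤ y → 0ℝ < y
0<-≤-trans {x} {y} (ε , ε>0 , M , h) x≤y with x≤y (½ ℚ.* ε) (0<½* ε>0)
... | N , k = ½ ℚ.* ε , 0<½* ε>0 , M ℕ.⊔ N , λ n p → let open ℚ.≤-Reasoning in begin
  0ℚ ℚ.+ ½ ℚ.* ε
    ≡⟨ solve 1 (λ d → con 0ℚ :+ d := (con 0ℚ :+ (d :+ d)) :- d) refl (½ ℚ.* ε) ⟩
  (0ℚ ℚ.+ (½ ℚ.* ε ℚ.+ ½ ℚ.* ε)) ℚ.- ½ ℚ.* ε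
    ≡⟨ cong (λ u → (0ℚ ℚ.+ u) ℚ.- ½ ℚ.* ε) (½+½ ε) ⟩
  (0ℚ ℚ.+ ε) ℚ.- ½ ℚ.* ε
    ≤⟨ ℚ.+-monoˡ-≤ (ℚ.- (½ ℚ.* ε))
         (ℚ.≤-trans (h n (ℕ.m⊔n≤o⇒m≤o M N p)) (k n (ℕ.m⊔n≤o⇒n≤o M N p))) ⟩
  (seq y n ℚ.+ ½ ℚ.* ε) ℚ.- ½ ℚ.* ε
    ≡⟨ solve 2 (λ a d → (a :+ d) :- d := a) refl (seq y n) (½ ℚ.* ε) ⟩
  seq y n ∎
  where open +-*-Solver

0<+ : ∀ {x y} → 0ℝ < x → 0ℝ ≤ y → 0ℝ < x + y
0<+ {x} {y} x>0@(ε , ε>0 , M , h) 0≤y = 0<-≤-trans {x} {x + y} x>0 λ δ δ>0 →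
  let (N , k) = 0≤y δ δ>0 in N , λ n p → let open ℚ.≤-Reasoning in begin
    seq x n                        ≡⟨ ℚ.+-identityʳ (seq x n) ⟨
    seq x n ℚ.+ 0ℚ                 ≤⟨ ℚ.+-monoʳ-≤ (seq x n) (k n p) ⟩
    seq x n ℚ.+ (seq y n ℚ.+ δ)    ≡⟨ ℚ.+-assoc (seq x n) (seq y n) δ ⟨
    (seq x n ℚ.+ seq y n) ℚ.+ δ    ∎

0<⇒0≤ : ∀ {x} → 0ℝ < x → 0ℝ ≤ x
0<⇒0≤ {x} (ε , ε>0 , M , h) δ δ>0 = M , λ n p →
  ℚ.≤-trans (ℚ.<⇒≤ ε>0) (ℚ.≤-trans (ℚ.≤-reflexive (sym (ℚ.+-identityˡ ε)))
    (ℚ.≤-trans (h n p) (ℚ.≤-trans (ℚ.≤-reflexive (sym (ℚ.+-identityʳ (seq x n))))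
      (ℚ.+-monoʳ-≤ (seq x n) (ℚ.<⇒≤ δ>0)))))

sum-pos : ∀ {m} (v : Vector ℝ (suc m)) → (∀ i → 0ℝ < v i) → 0ℝ < sum v
sum-pos v v>0 = 0<+ {v zero} {sum (λ i → v (suc i))} (v>0 zero)
                    (sum-nonNeg (λ i → v (suc i)) (λ i → v>0 (suc i)))
  where
  sum-nonNeg : ∀ {m} (w : Vector ℝ m) → (∀ i → 0ℝ < w i) → 0ℝ ≤ sum w
  sum-nonNeg {zero}  w w>0 = λ δ δ>0 → 0 , λ _ _ →
    ℚ.≤-trans (ℚ.<⇒≤ δ>0) (ℚ.≤-reflexive (sym (ℚ.+-identityˡ δ)))
  sum-nonNeg {suc m} w w>0 = 0<⇒0≤ {sum w} (sum-pos w w>0)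

------------------------------------------------------------------------
-- Families of subsets of [n]; the ground set {1,…,n} is Fin n

record Family (n : ℕ) : Set where
  constructor family
  field
    sets   : List (Subset n)
    unique : Unique sets

open Family public

size : ∀ {n} → Family n → ℕ
size 𝓐 = length (sets 𝓐)

record RainbowMatching {n m} (𝓐 : Vector (Family n) m) (r : ℕ) : Set where
  field
    index      : Fin r → Fin m
    increasing : ∀ {a b} → a Fin.< b → index a Fin.< index b
    set        : Fin r → Subset n
    member     : ∀ a → set a ∈ sets (𝓐 (index a))
    disjoint   : ∀ {a b} → a ≢ b → Empty (set a ∩ set b)

-- ν(𝓑₀,…,𝓑ₛ) ≤ s, where ν is the largest size of a rainbow matching.
Overlapping : ∀ {n s} → Vector (Family n) (suc s) → Set
Overlapping {s = s} 𝓑 = ∀ r → RainbowMatching 𝓑 r → r ℕ.≤ s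

record OverlappingChain (n k s : ℕ) : Set where
  field
    𝓑           : Vector (Family n) (suc s)
    uniform     : ∀ i {A} → A ∈ sets (𝓑 i) → ∣ A ∣ ≡ k
    chain       : ∀ {i j} → i Fin.≤ j → sets (𝓑 i) ⊆ sets (𝓑 j)
    overlapping : Overlapping 𝓑

-- IsMaximum (weight {n} {k} p) v says that f_p(n,k,s) = v.
weight : ∀ {n k s} → Vector ℝ (suc s) → OverlappingChain n k s → ℝ
weight p C = sum (λ i → p i * ofℕ (size (OverlappingChain.𝓑 C i)))

weights-pos : ∀ {s} (p : Vector ℝ (suc s)) → Antitonic₁ Fin._≤_ _≤_ p →
              0ℝ < p (fromℕ s) → ∀ i → 0ℝ < p i
weights-pos p p↓ pₛ>0 i = 0<-≤-trans {p (fromℕ _)} {p i} pₛ>0 (p↓ (≤fromℕ i))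

-- i : Fin s stands for the index toℕ i + 1 ∈ {1,…,s}; the vector is
-- (p₁,…,p_{toℕ i + 1}), omitting p₀.
initial : ∀ {s} → Vector ℝ (suc s) → (i : Fin s) → Vector ℝ (suc (toℕ i))
initial p i j = p (suc (inject≤ j (toℕ<n i)))

d : ∀ {s} .{{_ : NonZero s}} (p : Vector ℝ (suc s)) → (∀ i → 0ℝ < p i) → ℝ
d p p>0 = maximum λ i →
  ofℕ (suc (toℕ i)) * sum p / sum (initial p i) ⟨ sum-pos (initial p i) (λ _ → p>0 _) ⟩

{-# OPTIONS --safe #-}
-- Write t for the larger of ⌈d⌉ and 1, so that t k ≤ n. If A₁,…,A_t are disjoint
-- k-sets and bⱼ of them lie in 𝓑ⱼ, then bᵢ ≤ i for some i, since otherwise a rainbow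
-- matching of size s + 1 could be chosen greedily. As b₀ ≤ … ≤ bᵢ ≤ i and all bⱼ ≤ t,
-- the definition of d gives Σ pⱼ bⱼ ≤ i (p₀+…+pᵢ) + t (pᵢ₊₁+…+pₛ) ≤ t (p₁+…+pₛ).
-- Averaging over all t-tuples of disjoint k-sets turns this into the upper bound.
-- Equality holds for 𝓑₀ = ∅ and 𝓑₁ = … = 𝓑ₛ = all k-sets.
--
-- The combinatorial part is carried out for rational weights with an error term δ
-- and applied to the terms of the Cauchy sequences of the pⱼ.
module Submission where

open import Defs
open import Algebra.Bundles using (CommutativeRing)
import Algebra.Properties.Semiring.Sum as SemiringSum
open import Data.Bool.Base using (Bool; true; false; if_then_else_)
import Data.Bool.Properties as Bool
open import Data.Fin.Base as Fin using (Fin; zero; suc; toℕ; fromℕ; punchIn; inject≤)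
import Data.Fin.Properties as Fin
open import Data.Fin.Subset as Subset using (Subset; Empty; _∩_; ∣_∣; inside; outside)
open import Data.Fin.Subset.Properties using (x∈p∩q⁻)
open import Data.Integer.Base as ℤ using (ℤ; +_)
import Data.Integer.Properties as ℤ
open import Data.List.Base using (List; []; _∷_; _++_; map; length; filter; lookup)
open import Data.List.Membership.Propositional using (_∈_)
import Data.List.Membership.DecPropositional as DecMembership
open import Data.List.Membership.Propositional.Properties
  using (∈-filter⁺; ∈-map⁺; ∈-map⁻; ∈-++⁺ˡ; ∈-++⁺ʳ; ∈-++⁻; ∈-lookup)
import Data.List.Membership.Setoid.Properties as SetoidMembership
import Data.List.Properties as List
open import Data.List.Relation.Unary.All as All using ([]; _∷_)
open import Data.List.Relation.Unary.AllPairs using ([]; _∷_)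
open import Data.List.Relation.Unary.Any as Any using (here)
open import Data.List.Relation.Unary.Unique.Propositional using (Unique)
import Data.List.Relation.Unary.Unique.Propositional.Properties as Unique
open import Data.Nat.Base as ℕ using (ℕ; zero; suc; pred; z≤n; s≤s; NonZero; _!)
open import Data.Nat.Combinatorics using (_C_; nCk+nC[k+1]≡[n+1]C[k+1])
import Data.Nat.Properties as ℕ
open import Data.Nat.Solver using () renaming (module +-*-Solver to ℕ-Solver)
open import Data.Product.Base using (∃; _×_; _,_; proj₁; proj₂)
open import Data.Rational.Base as ℚ using (ℚ; 0ℚ; 1ℚ)
import Data.Rational.Properties as ℚ
open import Data.Rational.Solver using (module +-*-Solver)
import Data.Rational.Unnormalised.Base as ℚᵘ
import Data.Rational.Unnormalised.Properties as ℚᵘ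
open import Data.Sum.Base using (inj₁; inj₂)
open import Data.Vec.Base using ([]; _∷_; here; there)
open import Data.Vec.Functional using (Vector; tail; removeAt)
import Data.Vec.Properties as Vec
open import Function.Base using (_∘_; const)
open import Function.Definitions using (Injective)
open import Relation.Binary.Definitions using (Antitonic₁; tri<; tri≈; tri>)
open import Relation.Binary.PropositionalEquality
  using (_≡_; _≢_; refl; sym; trans; cong; cong₂; subst; setoid; module ≡-Reasoning)
open import Relation.Nullary.Decidable using (does; yes; no; dec-true)
open import Relation.Nullary.Negation using (contradiction)
open import Relation.Unary using (Decidable)

open +-*-Solver using (solve; _:+_; _:*_; _:-_; :-_; _:=_; con)

module ℚ∑ = SemiringSum (CommutativeRing.semiring ℚ.+-*-commutativeRing)
module ℕ∑ = SemiringSum ℕ.+-*-semiring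

-- Sums of rationals

-- Each term of the sequence of `ofℕ n` is `ι n` by computation, which lets the rational bounds
-- below be applied termwise.
ι : ℕ → ℚ
ι n = + n ℚ./ 1

ι-+ : ∀ m n → ι (m ℕ.+ n) ≡ ι m ℚ.+ ι n
-- `ℚ._/_` normalises by a gcd, so the equation is checked among unnormalised rationals with
-- denominator 1.
ι-+ m n = ℚ.toℚᵘ-injective (begin
  ℚ.toℚᵘ (ι (m ℕ.+ n))             ≈⟨ ℚ.toℚᵘ-fromℚᵘ (ℚᵘ.mkℚᵘ (+ (m ℕ.+ n)) 0) ⟩
  ℚᵘ.mkℚᵘ (+ (m ℕ.+ n)) 0
    ≈⟨ ℚᵘ.*≡* (cong (ℤ._* (+ 1))
         (sym (cong₂ ℤ._+_ (ℤ.*-identityʳ (+ m)) (ℤ.*-identityʳ (+ n))))) ⟩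
  ℚᵘ.mkℚᵘ (+ m) 0 ℚᵘ.+ ℚᵘ.mkℚᵘ (+ n) 0
    ≈⟨ ℚᵘ.+-cong (ℚ.toℚᵘ-fromℚᵘ (ℚᵘ.mkℚᵘ (+ m) 0)) (ℚ.toℚᵘ-fromℚᵘ (ℚᵘ.mkℚᵘ (+ n) 0)) ⟨
  ℚ.toℚᵘ (ι m) ℚᵘ.+ ℚ.toℚᵘ (ι n)   ≈⟨ ℚ.toℚᵘ-homo-+ (ι m) (ι n) ⟨
  ℚ.toℚᵘ (ι m ℚ.+ ι n)             ∎)
  where open ℚᵘ.≃-Reasoning

ι-* : ∀ m n → ι (m ℕ.* n) ≡ ι m ℚ.* ι n
ι-* zero    n = sym (ℚ.*-zeroˡ (ι n))
ι-* (suc m) n = begin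
  ι (n ℕ.+ m ℕ.* n)          ≡⟨ ι-+ n (m ℕ.* n) ⟩
  ι n ℚ.+ ι (m ℕ.* n)        ≡⟨ cong (ι n ℚ.+_) (ι-* m n) ⟩
  ι n ℚ.+ ι m ℚ.* ι n        ≡⟨ solve 2 (λ x y → y :+ x :* y := (con 1ℚ :+ x) :* y) refl (ι m) (ι n) ⟩
  (1ℚ ℚ.+ ι m) ℚ.* ι n       ≡⟨ cong (ℚ._* ι n) (ι-+ 1 m) ⟨
  ι (suc m) ℚ.* ι n          ∎
  where open ≡-Reasoning

0≤ι : ∀ n → 0ℚ ℚ.≤ ι n
0≤ι n = ℚ.nonNegative⁻¹ (ι n) {{ℚ.normalize-nonNeg n 1}}

0<ι : ∀ n .{{_ : NonZero n}} → 0ℚ ℚ.< ι n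
0<ι n = ℚ.positive⁻¹ (ι n) {{ℚ.normalize-pos n 1}}

ι-mono-≤ : ∀ {m n} → m ℕ.≤ n → ι m ℚ.≤ ι n
ι-mono-≤ {m} {n} m≤n = begin
  ι m                       ≡⟨ ℚ.+-identityʳ (ι m) ⟨
  ι m ℚ.+ 0ℚ                ≤⟨ ℚ.+-monoʳ-≤ (ι m) (0≤ι (n ℕ.∸ m)) ⟩
  ι m ℚ.+ ι (n ℕ.∸ m)       ≡⟨ ι-+ m (n ℕ.∸ m) ⟨
  ι (m ℕ.+ (n ℕ.∸ m))       ≡⟨ cong ι (ℕ.m+[n∸m]≡n m≤n) ⟩
  ι n                       ∎
  where open ℚ.≤-Reasoning

ι-∸ : ∀ {m n} → m ℕ.≤ n → ι (n ℕ.∸ m) ≡ ι n ℚ.- ι m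
ι-∸ {m} {n} m≤n = begin
  ι (n ℕ.∸ m)                      ≡⟨ solve 2 (λ x y → y := (x :+ y) :- x) refl (ι m) (ι (n ℕ.∸ m)) ⟩
  (ι m ℚ.+ ι (n ℕ.∸ m)) ℚ.- ι m    ≡⟨ cong (ℚ._- ι m) (ι-+ m (n ℕ.∸ m)) ⟨
  ι (m ℕ.+ (n ℕ.∸ m)) ℚ.- ι m      ≡⟨ cong (λ x → ι x ℚ.- ι m) (ℕ.m+[n∸m]≡n m≤n) ⟩
  ι n ℚ.- ι m                      ∎
  where open ≡-Reasoning

ι-sum : ∀ {m} (v : Vector ℕ m) → ι (ℕ∑.sum v) ≡ ℚ∑.sum (ι ∘ v)
ι-sum {zero}  v = refl
ι-sum {suc m} v = trans (ι-+ (v zero) (ℕ∑.sum (tail v))) (cong (ι (v zero) ℚ.+_) (ι-sum (tail v)))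

sum-mono : ∀ {m} {u v : Vector ℚ m} → (∀ i → u i ℚ.≤ v i) → ℚ∑.sum u ℚ.≤ ℚ∑.sum v
sum-mono {zero}  u≤v = ℚ.≤-refl
sum-mono {suc m} u≤v = ℚ.+-mono-≤ (u≤v zero) (sum-mono (u≤v ∘ suc))

sum-nonpos : ∀ {m} (u : Vector ℚ m) → (∀ i → u i ℚ.≤ 0ℚ) → ℚ∑.sum u ℚ.≤ 0ℚ
sum-nonpos {zero}  u u≤0 = ℚ.≤-refl
sum-nonpos {suc m} u u≤0 = ℚ.+-mono-≤ (u≤0 zero) (sum-nonpos (u ∘ suc) (u≤0 ∘ suc))

sum-const : ∀ m x → ℚ∑.sum {m} (const x) ≡ ι m ℚ.* x
sum-const zero    x = sym (ℚ.*-zeroˡ x)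
sum-const (suc m) x = begin
  x ℚ.+ ℚ∑.sum {m} (const x)   ≡⟨ cong (x ℚ.+_) (sum-const m x) ⟩
  x ℚ.+ ι m ℚ.* x              ≡⟨ solve 2 (λ m x → x :+ m :* x := (con 1ℚ :+ m) :* x) refl (ι m) x ⟩
  (1ℚ ℚ.+ ι m) ℚ.* x           ≡⟨ cong (ℚ._* x) (ι-+ 1 m) ⟨
  ι (suc m) ℚ.* x              ∎
  where open ≡-Reasoning

ℕ-sum-const : ∀ m x → ℕ∑.sum {m} (const x) ≡ m ℕ.* x
ℕ-sum-const zero    x = refl
ℕ-sum-const (suc m) x = cong (x ℕ.+_) (ℕ-sum-const m x)

-- The selecting Boolean is the very one that later serves in `permSum-average` as the bit saying
-- whether the first element lies in the a-th set.
replaceAt : ∀ {A : Set} {m} → Fin m → Vector A m → Vector A m → Vector A m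
replaceAt c x y a = if does (a Fin.≟ c) then x a else y a

sum-replaceAt : ∀ {m} (c : Fin m) x y →
                ℚ∑.sum (replaceAt c x y) ≡ ℚ∑.sum y ℚ.+ (x c ℚ.- y c)
sum-replaceAt zero    x y =
  solve 3 (λ x y s → x :+ s := (y :+ s) :+ (x :- y)) refl (x zero) (y zero) (ℚ∑.sum (tail y))
sum-replaceAt (suc c) x y = begin
  y zero ℚ.+ ℚ∑.sum (replaceAt c (tail x) (tail y))
    ≡⟨ cong (y zero ℚ.+_) (sum-replaceAt c (tail x) (tail y)) ⟩
  y zero ℚ.+ (ℚ∑.sum (tail y) ℚ.+ (x (suc c) ℚ.- y (suc c)))
    ≡⟨ ℚ.+-assoc (y zero) (ℚ∑.sum (tail y)) (x (suc c) ℚ.- y (suc c)) ⟨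
  (y zero ℚ.+ ℚ∑.sum (tail y)) ℚ.+ (x (suc c) ℚ.- y (suc c)) ∎
  where open ≡-Reasoning

-- Once the first element is placed in the c-th set, the remaining sizes add up to one less and so
-- still fit into the remaining ground set.
sum-replaceAt-pred : ∀ {m} (c : Fin m) (k : Vector ℕ m) .{{_ : NonZero (k c)}} →
                     suc (ℕ∑.sum (replaceAt c (pred ∘ k) k)) ≡ ℕ∑.sum k
sum-replaceAt-pred zero    k = cong (ℕ._+ ℕ∑.sum (tail k)) (ℕ.suc-pred (k zero))
sum-replaceAt-pred (suc c) k =
  trans (sym (ℕ.+-suc (k zero) _)) (cong (k zero ℕ.+_) (sum-replaceAt-pred c (tail k)))

entry≤sum : ∀ {m} (k : Vector ℕ m) i → k i ℕ.≤ ℕ∑.sum k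
entry≤sum k zero    = ℕ.m≤m+n (k zero) _
entry≤sum k (suc i) = ℕ.≤-trans (entry≤sum (tail k) i) (ℕ.m≤n+m _ (k zero))

-- Averaging over tuples of pairwise disjoint sets

PairwiseDisjoint : ∀ {n t} → Vector (Subset n) t → Set
PairwiseDisjoint A = ∀ {a b} → a ≢ b → Empty (A a ∩ A b)

-- k! (n − k)! times the sum of f over the k-subsets of [n], built by revealing
-- the elements of [n] one at a time.
permSum : ∀ n → ℕ → (Subset n → ℚ) → ℚ
permSum zero    k f = f []
permSum (suc n) k f = ι k ℚ.* permSum n (pred k) (f ∘ (inside ∷_))
                ℚ.+ ι (suc n ℕ.∸ k) ℚ.* permSum n k (f ∘ (outside ∷_))

-- Conditional on the first element lying in the a-th set (probability kₐ / n) or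
-- in none of them, the remaining data is an instance of the same problem.
permSum-average : ∀ n {t} (k : Vector ℕ t) (f : Fin t → Subset n → ℚ) → ℕ∑.sum k ℕ.≤ n →
  (∀ A → (∀ a → ∣ A a ∣ ≡ k a) → PairwiseDisjoint A → ℚ∑.sum (λ a → f a (A a)) ℚ.≤ 0ℚ) →
  ℚ∑.sum (λ a → permSum n (k a) (f a)) ℚ.≤ 0ℚ
-- On the empty ground set all sizes are 0, and the hypothesis is applied to the tuple of empty
-- sets.
permSum-average zero k f Σk≤0 f≤0 = f≤0 (λ _ → [])
  (λ a → sym (ℕ.n≤0⇒n≡0 (ℕ.≤-trans (entry≤sum k a) Σk≤0))) (λ _ ())
permSum-average (suc n) {t} k f Σk≤1+n f≤0 = begin
  -- The aim is to regroup into the sum over c of k c (ΣY + X c - Y c), plus (N - K) ΣY. The bracket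
  -- is the total over all sets when the first element lies in the c-th one; the last ΣY is the
  -- total when it lies in none.
  ℚ∑.sum (λ a → ι (k a) ℚ.* X a ℚ.+ ι (suc n ℕ.∸ k a) ℚ.* Y a)
    ≡⟨ ℚ∑.sum-cong-≗ (λ a → trans
         (cong (λ z → ι (k a) ℚ.* X a ℚ.+ z ℚ.* Y a) (ι-∸ (ℕ.≤-trans (entry≤sum k a) Σk≤1+n)))
         (solve 4 (λ k x y n → k :* x :+ (n :- k) :* y := k :* (x :- y) :+ n :* y) refl
            (ι (k a)) (X a) (Y a) N)) ⟩
  ℚ∑.sum (λ a → D a ℚ.+ N ℚ.* Y a)
    ≡⟨ ℚ∑.∑-distrib-+ D (λ a → N ℚ.* Y a) ⟩
  ℚ∑.sum D ℚ.+ ℚ∑.sum (λ a → N ℚ.* Y a)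
    ≡⟨ cong (ℚ∑.sum D ℚ.+_) (ℚ∑.*-distribˡ-sum N Y) ⟨
  ℚ∑.sum D ℚ.+ N ℚ.* ΣY
    ≡⟨ solve 4 (λ d n k y → d :+ n :* y := (k :* y :+ d) :+ (n :- k) :* y) refl
         (ℚ∑.sum D) N K ΣY ⟩
  (K ℚ.* ΣY ℚ.+ ℚ∑.sum D) ℚ.+ (N ℚ.- K) ℚ.* ΣY
    ≡⟨ cong (λ z → (z ℚ.+ ℚ∑.sum D) ℚ.+ (N ℚ.- K) ℚ.* ΣY) (trans
         (cong (ℚ._* ΣY) (ι-sum k)) (ℚ∑.*-distribʳ-sum ΣY (ι ∘ k))) ⟩
  (ℚ∑.sum (λ c → ι (k c) ℚ.* ΣY) ℚ.+ ℚ∑.sum D) ℚ.+ (N ℚ.- K) ℚ.* ΣY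
    ≡⟨ cong (ℚ._+ (N ℚ.- K) ℚ.* ΣY) (ℚ∑.∑-distrib-+ (λ c → ι (k c) ℚ.* ΣY) D) ⟨
  ℚ∑.sum (λ c → ι (k c) ℚ.* ΣY ℚ.+ D c) ℚ.+ (N ℚ.- K) ℚ.* ΣY
    ≤⟨ ℚ.+-mono-≤ (sum-nonpos _ first-in) first-out ⟩
  0ℚ ∎
  where
  open ℚ.≤-Reasoning
  N = ι (suc n)
  K = ι (ℕ∑.sum k)
  X Y D : Vector ℚ t
  X a = permSum n (pred (k a)) (f a ∘ (inside ∷_))
  Y a = permSum n (k a) (f a ∘ (outside ∷_))
  D a = ι (k a) ℚ.* (X a ℚ.- Y a)
  ΣY = ℚ∑.sum Y

  -- The new first element belongs to at most one of the sets, so it creates no intersection.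
  extend : (e : Fin t → Bool) {A : Vector (Subset n) t} →
           (∀ {a b} → a ≢ b → e a ≡ true → e b ≡ true → a ≡ b) →
           PairwiseDisjoint A → PairwiseDisjoint (λ a → e a ∷ A a)
  extend e {A} at-most-one dis {a} {b} a≢b (i , i∈) with x∈p∩q⁻ (e a ∷ A a) (e b ∷ A b) i∈
  extend e at-most-one dis a≢b (zero  , _) | p , q = a≢b (at-most-one a≢b (head p) (head q))
    where
    head : ∀ {x} {B : Subset n} → zero Subset.∈ (x ∷ B) → x ≡ true
    head here = refl
  extend e at-most-one dis a≢b (suc i , there i∈) | _ = dis a≢b (i , i∈)

  first-out : (N ℚ.- K) ℚ.* ΣY ℚ.≤ 0ℚ
  first-out with ℕ.m≤n⇒m<n∨m≡n Σk≤1+n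
  ... | inj₂ eq = ℚ.≤-reflexive (begin-equality
    (N ℚ.- K) ℚ.* ΣY  ≡⟨ cong (λ z → (N ℚ.- ι z) ℚ.* ΣY) eq ⟩
    (N ℚ.- N) ℚ.* ΣY  ≡⟨ solve 2 (λ n y → (n :- n) :* y := con 0ℚ) refl N ΣY ⟩
    0ℚ                ∎)
  ... | inj₁ (s≤s Σk≤n) = begin
    (N ℚ.- K) ℚ.* ΣY  ≤⟨ ℚ.*-monoˡ-≤-nonNeg (N ℚ.- K)
                           {{ℚ.nonNegative (subst (0ℚ ℚ.≤_) (ι-∸ Σk≤1+n) (0≤ι (suc n ℕ.∸ ℕ∑.sum k)))}}
                           (permSum-average n k (λ a → f a ∘ (outside ∷_)) Σk≤n
                             λ A sz dis → f≤0 (λ a → outside ∷ A a) sz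
                               (extend (const false) (λ _ ()) dis)) ⟩
    (N ℚ.- K) ℚ.* 0ℚ  ≡⟨ ℚ.*-zeroʳ (N ℚ.- K) ⟩
    0ℚ                ∎

  first-in : ∀ c → ι (k c) ℚ.* ΣY ℚ.+ D c ℚ.≤ 0ℚ
  first-in c with k c in kc≡
  -- An empty c-th set cannot receive the first element: the value of `X c` at `pred 0` is
  -- meaningless here, and the factor 0 removes it.
  ... | zero  = ℚ.≤-reflexive (solve 2 (λ x y → con 0ℚ :* x :+ con 0ℚ :* y := con 0ℚ) refl ΣY
                 (permSum n 0 (f c ∘ (inside ∷_)) ℚ.- permSum n 0 (f c ∘ (outside ∷_))))
  ... | suc j = begin
    ι (suc j) ℚ.* ΣY ℚ.+ ι (suc j) ℚ.* (X′ ℚ.- Y′)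
      ≡⟨ solve 3 (λ k y d → k :* y :+ k :* d := k :* (y :+ d)) refl (ι (suc j)) ΣY (X′ ℚ.- Y′) ⟩
    ι (suc j) ℚ.* (ΣY ℚ.+ (X′ ℚ.- Y′))
      ≡⟨ cong (λ z → ι (suc j) ℚ.* (ΣY ℚ.+ z)) (cong (λ z → permSum n (pred z) (f c ∘ (inside ∷_)) ℚ.-
               permSum n z (f c ∘ (outside ∷_))) kc≡) ⟨
    ι (suc j) ℚ.* (ΣY ℚ.+ (X c ℚ.- Y c))
      ≡⟨ cong (ι (suc j) ℚ.*_) (sum-replaceAt c X Y) ⟨
    ι (suc j) ℚ.* ℚ∑.sum (replaceAt c X Y)
      ≡⟨ cong (ι (suc j) ℚ.*_) (ℚ∑.sum-cong-≗ λ a → choose (does (a Fin.≟ c)) a) ⟩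
    ι (suc j) ℚ.* ℚ∑.sum (λ a → permSum n (k′ a) (f a ∘ (does (a Fin.≟ c) ∷_)))
      ≤⟨ ℚ.*-monoˡ-≤-nonNeg (ι (suc j)) {{ℚ.nonNegative (0≤ι (suc j))}}
           (permSum-average n k′ (λ a → f a ∘ (does (a Fin.≟ c) ∷_)) Σk′≤n
             λ A sz dis → f≤0 (λ a → does (a Fin.≟ c) ∷ A a) (sizes A sz)
               (extend (λ a → does (a Fin.≟ c)) coincide dis)) ⟩
    ι (suc j) ℚ.* 0ℚ
      ≡⟨ ℚ.*-zeroʳ (ι (suc j)) ⟩
    0ℚ ∎
    where
    X′ = permSum n j (f c ∘ (inside ∷_))
    Y′ = permSum n (suc j) (f c ∘ (outside ∷_))
    k′ : Vector ℕ t
    k′ = replaceAt c (pred ∘ k) k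
    instance
      kc≢0 : NonZero (k c)
      kc≢0 = subst NonZero (sym kc≡) _

    choose : ∀ x a → (if x then X a else Y a) ≡
             permSum n (if x then pred (k a) else k a) (f a ∘ (x ∷_))
    choose true  a = refl
    choose false a = refl

    Σk′≤n : ℕ∑.sum k′ ℕ.≤ n
    Σk′≤n = ℕ.s≤s⁻¹ (ℕ.≤-trans (ℕ.≤-reflexive (sum-replaceAt-pred c k)) Σk≤1+n)

    sizes : ∀ A → (∀ a → ∣ A a ∣ ≡ k′ a) → ∀ a → ∣ does (a Fin.≟ c) ∷ A a ∣ ≡ k a
    sizes A sz a with a Fin.≟ c | sz a
    ... | yes refl | e = trans (cong suc e) (ℕ.suc-pred (k c))
    ... | no _     | e = e

    coincide : ∀ {a b} → a ≢ b → does (a Fin.≟ c) ≡ true → does (b Fin.≟ c) ≡ true → a ≡ b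
    coincide {a} {b} _ _ _ with a Fin.≟ c | b Fin.≟ c
    coincide _ _ _  | yes refl | yes refl = refl
    coincide _ _ () | yes refl | no _
    coincide _ () _ | no _     | _

-- The list of k-subsets

subsets : ∀ n → ℕ → List (Subset n)
subsets zero    zero    = [] ∷ []
subsets zero    (suc k) = []
subsets (suc n) zero    = map (outside ∷_) (subsets n zero)
subsets (suc n) (suc k) = map (inside ∷_) (subsets n k) ++ map (outside ∷_) (subsets n (suc k))

length-subsets : ∀ n k → length (subsets n k) ≡ n C k
length-subsets zero    zero    = refl
length-subsets zero    (suc k) = refl
length-subsets (suc n) zero    = trans (List.length-map _ (subsets n zero)) (length-subsets n zero)
length-subsets (suc n) (suc k) = begin
  length (map (inside ∷_) (subsets n k) ++ map (outside ∷_) (subsets n (suc k)))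
    ≡⟨ List.length-++ (map (inside ∷_) (subsets n k)) ⟩
  length (map (inside ∷_) (subsets n k)) ℕ.+ length (map (outside ∷_) (subsets n (suc k)))
    ≡⟨ cong₂ ℕ._+_ (List.length-map _ (subsets n k)) (List.length-map _ (subsets n (suc k))) ⟩
  length (subsets n k) ℕ.+ length (subsets n (suc k))
    ≡⟨ cong₂ ℕ._+_ (length-subsets n k) (length-subsets n (suc k)) ⟩
  n C k ℕ.+ n C suc k
    ≡⟨ nCk+nC[k+1]≡[n+1]C[k+1] n k ⟩
  suc n C suc k ∎
  where open ≡-Reasoning

subsets-empty : ∀ {n k} → n ℕ.< k → subsets n k ≡ []
subsets-empty {zero}  {suc k} _ = refl
subsets-empty {suc n} {suc k} (s≤s n<k)
  rewrite subsets-empty n<k | subsets-empty (ℕ.m≤n⇒m≤1+n n<k) = refl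

-- Sums over all k-subsets and their bound by averaging

listSum : ∀ {A : Set} → (A → ℚ) → List A → ℚ
listSum f []       = 0ℚ
listSum f (x ∷ xs) = f x ℚ.+ listSum f xs

listSum-++ : ∀ {A : Set} (f : A → ℚ) xs ys → listSum f (xs ++ ys) ≡ listSum f xs ℚ.+ listSum f ys
listSum-++ f []       ys = sym (ℚ.+-identityˡ (listSum f ys))
listSum-++ f (x ∷ xs) ys =
  trans (cong (f x ℚ.+_) (listSum-++ f xs ys)) (sym (ℚ.+-assoc (f x) (listSum f xs) (listSum f ys)))

listSum-map : ∀ {A B : Set} (f : B → ℚ) (h : A → B) xs → listSum f (map h xs) ≡ listSum (f ∘ h) xs
listSum-map f h []       = refl
listSum-map f h (x ∷ xs) = cong (f (h x) ℚ.+_) (listSum-map f h xs)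

listSum-minus : ∀ {A : Set} (f : A → ℚ) c xs →
                listSum (λ x → f x ℚ.- c) xs ≡ listSum f xs ℚ.- ι (length xs) ℚ.* c
listSum-minus f c []       = solve 1 (λ c → con 0ℚ := con 0ℚ :- con 0ℚ :* c) refl c
listSum-minus f c (x ∷ xs) = begin
  (f x ℚ.- c) ℚ.+ listSum (λ x → f x ℚ.- c) xs
    ≡⟨ cong ((f x ℚ.- c) ℚ.+_) (listSum-minus f c xs) ⟩
  (f x ℚ.- c) ℚ.+ (listSum f xs ℚ.- ι (length xs) ℚ.* c)
    ≡⟨ solve 4 (λ x c s l → (x :- c) :+ (s :- l :* c) := (x :+ s) :- (con 1ℚ :+ l) :* c) refl
         (f x) c (listSum f xs) (ι (length xs)) ⟩
  (f x ℚ.+ listSum f xs) ℚ.- (1ℚ ℚ.+ ι (length xs)) ℚ.* c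
    ≡⟨ cong (λ l → (f x ℚ.+ listSum f xs) ℚ.- l ℚ.* c) (ι-+ 1 (length xs)) ⟨
  (f x ℚ.+ listSum f xs) ℚ.- ι (suc (length xs)) ℚ.* c ∎
  where open ≡-Reasoning

-- Induction along Pascal's rule: the factor for `inside` completes k ! and the factor for `outside`
-- completes l !, so both halves of the list acquire the same coefficient.
permSum-subsets : ∀ n k l (f : Subset n → ℚ) → k ℕ.+ l ≡ n →
                  permSum n k f ≡ ι (k ! ℕ.* l !) ℚ.* listSum f (subsets n k)
permSum-subsets zero zero zero f refl =
  solve 1 (λ x → x := con 1ℚ :* (x :+ con 0ℚ)) refl (f [])
permSum-subsets (suc n) zero (suc l) f refl = begin
  ι 0 ℚ.* P ℚ.+ ι (suc n) ℚ.* permSum n 0 (f ∘ (outside ∷_))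
    ≡⟨ cong (λ z → ι 0 ℚ.* P ℚ.+ ι (suc n) ℚ.* z) (permSum-subsets n zero l _ refl) ⟩
  ι 0 ℚ.* P ℚ.+ ι (suc n) ℚ.* (ι (0 ! ℕ.* n !) ℚ.* S)
    ≡⟨ solve 4 (λ p x y s → con 0ℚ :* p :+ x :* (y :* s) := (x :* y) :* s) refl
         P (ι (suc n)) (ι (0 ! ℕ.* n !)) S ⟩
  (ι (suc n) ℚ.* ι (0 ! ℕ.* n !)) ℚ.* S
    ≡⟨ cong₂ ℚ._*_ (trans (sym (ι-* (suc n) (0 ! ℕ.* n !)))
          (cong ι (ℕ-Solver.solve 2 (λ m x → m ℕ-Solver.:* (ℕ-Solver.con 1 ℕ-Solver.:* x)
              ℕ-Solver.:= ℕ-Solver.con 1 ℕ-Solver.:* (m ℕ-Solver.:* x)) refl (suc n) (n !))))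
        (sym (listSum-map f (outside ∷_) (subsets n zero))) ⟩
  ι (0 ! ℕ.* suc n !) ℚ.* listSum f (map (outside ∷_) (subsets n zero)) ∎
  where
  open ≡-Reasoning
  P = permSum n 0 (f ∘ (inside ∷_))
  S = listSum (f ∘ (outside ∷_)) (subsets n zero)
permSum-subsets (suc n) (suc k) l f eq = begin
  ι (suc k) ℚ.* permSum n k fᵢ ℚ.+ ι (n ℕ.∸ k) ℚ.* permSum n (suc k) fₒ
    ≡⟨ cong₂ ℚ._+_ (cong (ι (suc k) ℚ.*_) (permSum-subsets n k l fᵢ (ℕ.suc-injective eq)))
                   (trans (cong (λ z → ι z ℚ.* permSum n (suc k) fₒ) n∸k≡l) (out l eq)) ⟩
  ι (suc k) ℚ.* (ι (k ! ℕ.* l !) ℚ.* Sᵢ) ℚ.+ M ℚ.* Sₒ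
    ≡⟨ cong (ℚ._+ M ℚ.* Sₒ) (trans (sym (ℚ.*-assoc (ι (suc k)) (ι (k ! ℕ.* l !)) Sᵢ))
         (cong (ℚ._* Sᵢ) (trans (sym (ι-* (suc k) (k ! ℕ.* l !)))
           (cong ι (sym (ℕ.*-assoc (suc k) (k !) (l !))))))) ⟩
  M ℚ.* Sᵢ ℚ.+ M ℚ.* Sₒ
    ≡⟨ ℚ.*-distribˡ-+ M Sᵢ Sₒ ⟨
  M ℚ.* (Sᵢ ℚ.+ Sₒ)
    ≡⟨ cong (M ℚ.*_) (cong₂ ℚ._+_ (listSum-map f (inside ∷_) (subsets n k))
                                  (listSum-map f (outside ∷_) (subsets n (suc k)))) ⟨
  M ℚ.* (listSum f (map (inside ∷_) (subsets n k)) ℚ.+ listSum f (map (outside ∷_) (subsets n (suc k))))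
    ≡⟨ cong (M ℚ.*_) (listSum-++ f (map (inside ∷_) (subsets n k))
                                   (map (outside ∷_) (subsets n (suc k)))) ⟨
  M ℚ.* listSum f (subsets (suc n) (suc k)) ∎
  where
  open ≡-Reasoning
  fᵢ fₒ : Subset n → ℚ
  fᵢ = f ∘ (inside ∷_)
  fₒ = f ∘ (outside ∷_)
  Sᵢ = listSum fᵢ (subsets n k)
  Sₒ = listSum fₒ (subsets n (suc k))
  M  = ι (suc k ! ℕ.* l !)

  n∸k≡l : n ℕ.∸ k ≡ l
  n∸k≡l = trans (cong (ℕ._∸ k) (sym (ℕ.suc-injective eq))) (ℕ.m+n∸m≡n k l)

  out : ∀ l → suc k ℕ.+ l ≡ suc n →
        ι l ℚ.* permSum n (suc k) fₒ ≡ ι (suc k ! ℕ.* l !) ℚ.* Sₒ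
  -- For l = 0 the ground set that remains has only k elements: the left side carries the factor 0,
  -- and on the right there are no subsets of size k + 1.
  out zero eq = begin
    ι 0 ℚ.* permSum n (suc k) fₒ     ≡⟨ ℚ.*-zeroˡ (permSum n (suc k) fₒ) ⟩
    0ℚ                               ≡⟨ ℚ.*-zeroʳ (ι (suc k ! ℕ.* 0 !)) ⟨
    ι (suc k ! ℕ.* 0 !) ℚ.* 0ℚ
      ≡⟨ cong (λ L → ι (suc k ! ℕ.* 0 !) ℚ.* listSum fₒ L)
           (subsets-empty (ℕ.≤-reflexive (trans (sym eq) (ℕ.+-identityʳ (suc k))))) ⟨
    ι (suc k ! ℕ.* 0 !) ℚ.* Sₒ       ∎
  out (suc l) eq = begin
    ι (suc l) ℚ.* permSum n (suc k) fₒ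
      ≡⟨ cong (ι (suc l) ℚ.*_) (permSum-subsets n (suc k) l fₒ
           (ℕ.suc-injective (trans (sym (ℕ.+-suc (suc k) l)) eq))) ⟩
    ι (suc l) ℚ.* (ι (suc k ! ℕ.* l !) ℚ.* Sₒ)
      ≡⟨ ℚ.*-assoc (ι (suc l)) (ι (suc k ! ℕ.* l !)) Sₒ ⟨
    (ι (suc l) ℚ.* ι (suc k ! ℕ.* l !)) ℚ.* Sₒ
      ≡⟨ cong (ℚ._* Sₒ) (ι-* (suc l) (suc k ! ℕ.* l !)) ⟨
    ι (suc l ℕ.* (suc k ! ℕ.* l !)) ℚ.* Sₒ
      ≡⟨ cong (λ z → ι z ℚ.* Sₒ) (ℕ-Solver.solve 3 (λ a b c → a ℕ-Solver.:* (b ℕ-Solver.:* c)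
             ℕ-Solver.:= b ℕ-Solver.:* (a ℕ-Solver.:* c)) refl (suc l) (suc k !) (l !)) ⟩
    ι (suc k ! ℕ.* suc l !) ℚ.* Sₒ ∎

*-cancel-nonpos : ∀ {x y} → 0ℚ ℚ.< x → x ℚ.* y ℚ.≤ 0ℚ → y ℚ.≤ 0ℚ
*-cancel-nonpos {x} {y} x>0 xy≤0 = ℚ.*-cancelˡ-≤-pos x {{ℚ.positive x>0}}
  (ℚ.≤-trans xy≤0 (ℚ.≤-reflexive (sym (ℚ.*-zeroʳ x))))

p-q≤0⇒p≤q : ∀ p q → p ℚ.- q ℚ.≤ 0ℚ → p ℚ.≤ q
p-q≤0⇒p≤q p q h = begin
  p               ≡⟨ solve 2 (λ p q → p := (p :- q) :+ q) refl p q ⟩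
  (p ℚ.- q) ℚ.+ q ≤⟨ ℚ.+-monoˡ-≤ q h ⟩
  0ℚ ℚ.+ q        ≡⟨ ℚ.+-identityˡ q ⟩
  q               ∎
  where open ℚ.≤-Reasoning

-- `permSum-average` is applied to t equal sizes k and t copies of f = g - c. All t averages
-- coincide, so the positive factors t and k ! (n - k) ! can be cancelled, leaving the sum of f over
-- the k-subsets.
sum-subsets-≤ : ∀ {n} t k (g : Subset n → ℚ) c .{{_ : NonZero t}} → t ℕ.* k ℕ.≤ n →
  (∀ (A : Vector (Subset n) t) → (∀ a → ∣ A a ∣ ≡ k) → PairwiseDisjoint A →
     ℚ∑.sum (g ∘ A) ℚ.≤ ι t ℚ.* c) →
  listSum g (subsets n k) ℚ.≤ ι (n C k) ℚ.* c
sum-subsets-≤ {n} t k g c tk≤n g≤ = p-q≤0⇒p≤q _ _ (begin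
  listSum g (subsets n k) ℚ.- ι (n C k) ℚ.* c
    ≡⟨ cong (λ l → listSum g (subsets n k) ℚ.- ι l ℚ.* c) (length-subsets n k) ⟨
  listSum g (subsets n k) ℚ.- ι (length (subsets n k)) ℚ.* c
    ≡⟨ listSum-minus g c (subsets n k) ⟨
  listSum f (subsets n k)
    ≤⟨ *-cancel-nonpos (0<ι M) (ℚ.≤-trans
         (ℚ.≤-reflexive (sym (permSum-subsets n k (n ℕ.∸ k) f (ℕ.m+[n∸m]≡n k≤n))))
         (*-cancel-nonpos (0<ι t) (ℚ.≤-trans
           (ℚ.≤-reflexive (sym (sum-const t (permSum n k f))))
           (permSum-average n (const k) (const f)
             (ℕ.≤-trans (ℕ.≤-reflexive (ℕ-sum-const t k)) tk≤n) f≤0)))) ⟩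
  0ℚ ∎)
  where
  open ℚ.≤-Reasoning
  f : Subset n → ℚ
  f A = g A ℚ.- c
  k≤n : k ℕ.≤ n
  k≤n = ℕ.≤-trans (ℕ.m≤n*m k t) tk≤n
  M : ℕ
  M = k ! ℕ.* (n ℕ.∸ k) !
  instance
    M≢0 : NonZero M
    M≢0 = ℕ.m*n≢0 (k !) ((n ℕ.∸ k) !) {{k ℕ.!≢0}} {{(n ℕ.∸ k) ℕ.!≢0}}
  f≤0 : ∀ (A : Vector (Subset n) t) → (∀ a → ∣ A a ∣ ≡ k) → PairwiseDisjoint A →
        ℚ∑.sum (f ∘ A) ℚ.≤ 0ℚ
  f≤0 A sz dis = begin
    ℚ∑.sum (f ∘ A)
      ≡⟨ ℚ∑.∑-distrib-+ (g ∘ A) (const (ℚ.- c)) ⟩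
    ℚ∑.sum (g ∘ A) ℚ.+ ℚ∑.sum {t} (const (ℚ.- c))
      ≡⟨ cong (ℚ∑.sum (g ∘ A) ℚ.+_) (sum-const t (ℚ.- c)) ⟩
    ℚ∑.sum (g ∘ A) ℚ.+ ι t ℚ.* (ℚ.- c)
      ≤⟨ ℚ.+-monoˡ-≤ (ι t ℚ.* (ℚ.- c)) (g≤ A sz dis) ⟩
    ι t ℚ.* c ℚ.+ ι t ℚ.* (ℚ.- c)
      ≡⟨ solve 2 (λ t c → t :* c :+ t :* (:- c) := con 0ℚ) refl (ι t) c ⟩
    0ℚ ∎

-- Membership in the list of k-subsets, and lists without repetition

∈-subsets : ∀ {n k} (A : Subset n) → ∣ A ∣ ≡ k → A ∈ subsets n k
∈-subsets []                            refl = here refl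
∈-subsets (true  ∷ A)                   refl = ∈-++⁺ˡ (∈-map⁺ (inside ∷_) (∈-subsets A refl))
∈-subsets {suc n} {zero}  (false ∷ A)   eq   = ∈-map⁺ (outside ∷_) (∈-subsets A eq)
∈-subsets {suc n} {suc k} (false ∷ A)   eq   =
  ∈-++⁺ʳ (map (inside ∷_) (subsets n k)) (∈-map⁺ (outside ∷_) (∈-subsets A eq))

subsets-size : ∀ n k {A} → A ∈ subsets n k → ∣ A ∣ ≡ k
subsets-size zero    zero    (here refl) = refl
subsets-size (suc n) zero    A∈ with ∈-map⁻ (outside ∷_) A∈
... | _ , B∈ , refl = subsets-size n zero B∈
subsets-size (suc n) (suc k) A∈ with ∈-++⁻ (map (inside ∷_) (subsets n k)) A∈
... | inj₁ A∈ᵢ with ∈-map⁻ (inside ∷_) A∈ᵢ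
...   | _ , B∈ , refl = cong suc (subsets-size n k B∈)
subsets-size (suc n) (suc k) A∈ | inj₂ A∈ₒ with ∈-map⁻ (outside ∷_) A∈ₒ
...   | _ , B∈ , refl = subsets-size n (suc k) B∈

subsets-unique : ∀ n k → Unique (subsets n k)
subsets-unique zero    zero    = [] ∷ []
subsets-unique zero    (suc k) = []
subsets-unique (suc n) zero    = Unique.map⁺ Vec.∷-injectiveʳ (subsets-unique n zero)
subsets-unique (suc n) (suc k) = Unique.++⁺
  (Unique.map⁺ Vec.∷-injectiveʳ (subsets-unique n k))
  (Unique.map⁺ Vec.∷-injectiveʳ (subsets-unique n (suc k)))
  disjoint
  where
  disjoint : ∀ {A} → A ∈ map (inside ∷_) (subsets n k) × A ∈ map (outside ∷_) (subsets n (suc k)) → _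
  disjoint (p , q) with ∈-map⁻ (inside ∷_) p | ∈-map⁻ (outside ∷_) q
  ... | _ , _ , refl | _ , _ , ()

lookup-injective : ∀ {A : Set} {xs : List A} → Unique xs → Injective _≡_ _≡_ (lookup xs)
lookup-injective (_ ∷ _)     {zero}  {zero}  _  = refl
lookup-injective {xs = _ ∷ xs} (x∉ ∷ _) {zero} {suc j} eq =
  contradiction eq (All.lookup x∉ (∈-lookup j))
lookup-injective {xs = _ ∷ xs} (x∉ ∷ _) {suc i} {zero} eq =
  contradiction (sym eq) (All.lookup x∉ (∈-lookup i))
lookup-injective (_ ∷ uniq)  {suc i} {suc j} eq = cong suc (lookup-injective uniq eq)

-- Sending each position in xs to a position of the same element in ys is injective, because xs has
-- no repetitions.
unique⊆⇒length≤ : ∀ {A : Set} {xs ys : List A} → Unique xs → (∀ {x} → x ∈ xs → x ∈ ys) →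
                  length xs ℕ.≤ length ys
unique⊆⇒length≤ {A} {xs} {ys} uniq xs⊆ys = Fin.injective⇒≤ {f = λ i → Any.index (f i)} λ {i} {j} eq →
  lookup-injective uniq (SetoidMembership.index-injective (setoid A) (f i) (f j) eq)
  where
  f : ∀ i → lookup xs i ∈ ys
  f i = xs⊆ys (∈-lookup i)

-- Distinct representatives

𝟙 : Bool → ℕ
𝟙 true  = 1
𝟙 false = 0

count : ∀ {t} → (Fin t → Bool) → ℕ
count e = ℕ∑.sum (𝟙 ∘ e)

count-mono : ∀ {t} {e e′ : Fin t → Bool} → (∀ a → e a ≡ true → e′ a ≡ true) → count e ℕ.≤ count e′
count-mono {zero}  e≤e′ = z≤n
count-mono {suc t} {e} {e′} e≤e′ = ℕ.+-mono-≤ head (count-mono (e≤e′ ∘ suc))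
  where
  head : 𝟙 (e zero) ℕ.≤ 𝟙 (e′ zero)
  head with e zero in eq
  ... | false = z≤n
  ... | true rewrite e≤e′ zero eq = ℕ.≤-refl

count≤ : ∀ {t} (e : Fin t → Bool) → count e ℕ.≤ t
count≤ {zero}  e = z≤n
count≤ {suc t} e with e zero
... | true  = s≤s (count≤ (e ∘ suc))
... | false = ℕ.m≤n⇒m≤1+n (count≤ (e ∘ suc))

count>0⇒∃ : ∀ {t} (e : Fin t → Bool) → 0 ℕ.< count e → ∃ λ a → e a ≡ true
count>0⇒∃ {suc t} e 0<c with e zero in eq
... | true  = zero , eq
... | false with count>0⇒∃ (e ∘ suc) 0<c
...   | a , ea = suc a , ea

count-removeAt : ∀ {t} (e : Fin (suc t) → Bool) a → count e ℕ.≤ suc (count (removeAt e a))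
count-removeAt e a = begin
  count e                              ≡⟨ ℕ∑.sum-remove {i = a} (𝟙 ∘ e) ⟩
  𝟙 (e a) ℕ.+ count (removeAt e a)     ≤⟨ ℕ.+-monoˡ-≤ _ (𝟙≤1 (e a)) ⟩
  suc (count (removeAt e a))           ∎
  where
  open ℕ.≤-Reasoning
  𝟙≤1 : ∀ b → 𝟙 b ℕ.≤ 1
  𝟙≤1 true  = ℕ.≤-refl
  𝟙≤1 false = z≤n

-- Greedy choice in place of Hall's theorem. Pick any a allowed for index 0 and delete it: every
-- later count drops by at most one, and every later index drops by exactly one, so the strict
-- inequalities survive.
distinct-representatives : ∀ {m t} (e : Fin m → Fin t → Bool) → (∀ j → toℕ j ℕ.< count (e j)) →
  ∃ λ (σ : Fin m → Fin t) → Injective _≡_ _≡_ σ × (∀ j → e j (σ j) ≡ true)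
distinct-representatives {zero}  {t} e _ = (λ ()) , (λ { {()} }) , λ ()
distinct-representatives {suc m} {zero}  e j<c with () ← j<c zero
distinct-representatives {suc m} {suc t} e j<c with count>0⇒∃ (e zero) (j<c zero)
... | a , ea
  with distinct-representatives (λ j → removeAt (e (suc j)) a)
         (λ j → ℕ.s≤s⁻¹ (ℕ.≤-trans (j<c (suc j)) (count-removeAt (e (suc j)) a)))
... | σ , σ-inj , eσ = τ , τ-inj , eτ
  where
  τ : Fin (suc m) → Fin (suc t)
  τ zero    = a
  τ (suc j) = punchIn a (σ j)

  τ-inj : Injective _≡_ _≡_ τ
  τ-inj {zero}  {zero}  _  = refl
  τ-inj {zero}  {suc j} eq = contradiction (sym eq) (Fin.punchInᵢ≢i a (σ j))
  τ-inj {suc i} {zero}  eq = contradiction eq (Fin.punchInᵢ≢i a (σ i))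
  τ-inj {suc i} {suc j} eq = cong suc (σ-inj (Fin.punchIn-injective a (σ i) (σ j) eq))

  eτ : ∀ j → e j (τ j) ≡ true
  eτ zero    = ea
  eτ (suc j) = eσ j

-- An inequality for prefix sums

-- The rational counterpart of `initial`, indexed in the same way so that the two agree termwise by
-- computation.
prefix : ∀ {s} → Vector ℚ s → (i : Fin s) → Vector ℚ (suc (toℕ i))
prefix v i j = v (inject≤ j (Fin.toℕ<n i))

-- With P the prefix sum of v up to i and V its full sum, the entries of u up to i contribute at
-- most x P and the later ones at most y (V - P). Adding y P gives x P + y V, and P may be enlarged
-- to V since x and v are nonnegative. The full sum V is what the definition of `d` calls for, its
-- numerators containing all the weights.
two-level-sum : ∀ {s} (u v : Vector ℚ s) (x y : ℚ) (i : Fin s) → 0ℚ ℚ.≤ x →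
  (∀ j → 0ℚ ℚ.≤ v j) → (∀ j → j Fin.≤ i → u j ℚ.≤ x ℚ.* v j) → (∀ j → u j ℚ.≤ y ℚ.* v j) →
  ℚ∑.sum u ℚ.+ y ℚ.* ℚ∑.sum (prefix v i) ℚ.≤ x ℚ.* ℚ∑.sum v ℚ.+ y ℚ.* ℚ∑.sum v
two-level-sum {suc s} u v x y zero 0≤x 0≤v u≤xv u≤yv = begin
  (u zero ℚ.+ U) ℚ.+ y ℚ.* (v zero ℚ.+ 0ℚ)
    ≤⟨ ℚ.+-monoˡ-≤ (y ℚ.* (v zero ℚ.+ 0ℚ)) (ℚ.+-mono-≤ (u≤xv zero z≤n) U≤) ⟩
  (x ℚ.* v zero ℚ.+ (x ℚ.* V ℚ.+ y ℚ.* V)) ℚ.+ y ℚ.* (v zero ℚ.+ 0ℚ)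
    ≡⟨ solve 4 (λ x y a b → (x :* a :+ (x :* b :+ y :* b)) :+ y :* (a :+ con 0ℚ)
                          := x :* (a :+ b) :+ y :* (a :+ b)) refl x y (v zero) V ⟩
  x ℚ.* (v zero ℚ.+ V) ℚ.+ y ℚ.* (v zero ℚ.+ V) ∎
  where
  open ℚ.≤-Reasoning
  U = ℚ∑.sum (tail u)
  V = ℚ∑.sum (tail v)
  0≤V : 0ℚ ℚ.≤ V
  0≤V = ℚ.≤-trans (ℚ.≤-reflexive (sym (ℚ∑.sum-replicate-zero s))) (sum-mono (0≤v ∘ suc))
  U≤ : U ℚ.≤ x ℚ.* V ℚ.+ y ℚ.* V
  U≤ = begin
    U                          ≤⟨ sum-mono (u≤yv ∘ suc) ⟩
    ℚ∑.sum (λ j → y ℚ.* v (suc j)) ≡⟨ ℚ∑.*-distribˡ-sum y (tail v) ⟨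
    y ℚ.* V                    ≡⟨ ℚ.+-identityˡ (y ℚ.* V) ⟨
    0ℚ ℚ.+ y ℚ.* V             ≤⟨ ℚ.+-monoˡ-≤ (y ℚ.* V) (ℚ.≤-trans
                                   (ℚ.≤-reflexive (sym (ℚ.*-zeroʳ x)))
                                   (ℚ.*-monoˡ-≤-nonNeg x {{ℚ.nonNegative 0≤x}} 0≤V)) ⟩
    x ℚ.* V ℚ.+ y ℚ.* V        ∎
two-level-sum {suc s} u v x y (suc i) 0≤x 0≤v u≤xv u≤yv = begin
  (u zero ℚ.+ U) ℚ.+ y ℚ.* (v zero ℚ.+ P)
    ≡⟨ solve 5 (λ u U y v P → (u :+ U) :+ y :* (v :+ P) := (u :+ y :* v) :+ (U :+ y :* P)) refl
         (u zero) U y (v zero) P ⟩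
  (u zero ℚ.+ y ℚ.* v zero) ℚ.+ (U ℚ.+ y ℚ.* P)
    ≤⟨ ℚ.+-mono-≤ (ℚ.+-monoˡ-≤ (y ℚ.* v zero) (u≤xv zero z≤n))
         (two-level-sum (tail u) (tail v) x y i 0≤x (0≤v ∘ suc)
           (λ j j≤i → u≤xv (suc j) (s≤s j≤i)) (u≤yv ∘ suc)) ⟩
  (x ℚ.* v zero ℚ.+ y ℚ.* v zero) ℚ.+ (x ℚ.* V ℚ.+ y ℚ.* V)
    ≡⟨ solve 4 (λ x y a b → (x :* a :+ y :* a) :+ (x :* b :+ y :* b)
                          := x :* (a :+ b) :+ y :* (a :+ b)) refl x y (v zero) V ⟩
  x ℚ.* (v zero ℚ.+ V) ℚ.+ y ℚ.* (v zero ℚ.+ V) ∎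
  where
  open ℚ.≤-Reasoning
  U = ℚ∑.sum (tail u)
  V = ℚ∑.sum (tail v)
  P = ℚ∑.sum (prefix (tail v) i)

-- Overlapping chains with rational weights

length-filter-∷ : ∀ {A : Set} {P : A → Set} (P? : Decidable P) x xs →
                  length (filter P? (x ∷ xs)) ≡ 𝟙 (does (P? x)) ℕ.+ length (filter P? xs)
length-filter-∷ P? x xs with does (P? x)
... | true  = refl
... | false = refl

module _ {n k s} (𝒞 : OverlappingChain n k s) where

  open OverlappingChain 𝒞
  open DecMembership (Vec.≡-dec {n = n} Bool._≟_) using (_∈?_)

  member? : Fin (suc s) → Subset n → Bool
  member? j A = does (A ∈? sets (𝓑 j))

  member?⇒∈ : ∀ j A → member? j A ≡ true → A ∈ sets (𝓑 j)
  member?⇒∈ j A eq with A ∈? sets (𝓑 j)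
  ... | yes A∈ = A∈

  hits : ∀ {t} → Vector (Subset n) t → Fin (suc s) → ℕ
  hits A j = count (λ a → member? j (A a))

  hits-mono : ∀ {t} (A : Vector (Subset n) t) {i j} → i Fin.≤ j → hits A i ℕ.≤ hits A j
  hits-mono A {i} {j} i≤j = count-mono λ a eq →
    dec-true (A a ∈? sets (𝓑 j)) (chain i≤j (member?⇒∈ i (A a) eq))

  -- Otherwise the j-th family contains more than j of the sets for every j, and distinct
  -- representatives give a rainbow matching that uses all s + 1 families, each at its own index.
  ∃-few-hits : ∀ {t} (A : Vector (Subset n) t) → PairwiseDisjoint A → ∃ λ j → hits A j ℕ.≤ toℕ j
  ∃-few-hits A dis with Fin.any? (λ j → hits A j ℕ.≤? toℕ j)
  ... | yes few = few
  ... | no ¬few with distinct-representatives (λ j a → member? j (A a))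
                       (λ j → ℕ.≰⇒> λ h → ¬few (j , h))
  ...   | σ , σ-inj , eσ = contradiction (overlapping (suc s) (record
            { index      = λ j → j
            ; increasing = λ a<b → a<b
            ; set        = A ∘ σ
            ; member     = λ j → member?⇒∈ j (A (σ j)) (eσ j)
            ; disjoint   = λ a≢b → dis (a≢b ∘ σ-inj)
            })) ℕ.1+n≰n

  module _ (q : Vector ℚ (suc s)) (0≤q : ∀ j → 0ℚ ℚ.≤ q j) where

    -- Double counting: summing this over the sets of a tuple gives its weighted `hits`, while
    -- summing it over all k-subsets bounds the weight of the chain. Thus `sum-subsets-≤` passes
    -- from the first to the second.
    setWeight : Subset n → ℚ
    setWeight A = ℚ∑.sum (λ j → q j ℚ.* ι (𝟙 (member? j A)))

    sum-setWeight : ∀ {t} (A : Vector (Subset n) t) →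
                    ℚ∑.sum (setWeight ∘ A) ≡ ℚ∑.sum (λ j → q j ℚ.* ι (hits A j))
    sum-setWeight A = trans (ℚ∑.∑-comm (λ a j → q j ℚ.* ι (𝟙 (member? j (A a)))))
      (ℚ∑.sum-cong-≗ λ j → trans (sym (ℚ∑.*-distribˡ-sum (q j) (λ a → ι (𝟙 (member? j (A a))))))
        (cong (q j ℚ.*_) (sym (ι-sum (λ a → 𝟙 (member? j (A a)))))))

    listSum-setWeight : ∀ L → listSum setWeight L ≡
                        ℚ∑.sum (λ j → q j ℚ.* ι (length (filter (_∈? sets (𝓑 j)) L)))
    listSum-setWeight [] =
      sym (trans (ℚ∑.sum-cong-≗ λ j → ℚ.*-zeroʳ (q j)) (ℚ∑.sum-replicate-zero (suc s)))
    listSum-setWeight (A ∷ L) = begin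
      setWeight A ℚ.+ listSum setWeight L
        ≡⟨ cong (setWeight A ℚ.+_) (listSum-setWeight L) ⟩
      setWeight A ℚ.+ ℚ∑.sum (λ j → q j ℚ.* ι (rest j))
        ≡⟨ ℚ∑.∑-distrib-+ (λ j → q j ℚ.* ι (𝟙 (member? j A))) (λ j → q j ℚ.* ι (rest j)) ⟨
      ℚ∑.sum (λ j → q j ℚ.* ι (𝟙 (member? j A)) ℚ.+ q j ℚ.* ι (rest j))
        ≡⟨ ℚ∑.sum-cong-≗ (λ j → trans
             (sym (ℚ.*-distribˡ-+ (q j) (ι (𝟙 (member? j A))) (ι (rest j))))
             (cong (q j ℚ.*_) (trans (sym (ι-+ (𝟙 (member? j A)) (rest j)))
               (cong ι (sym (length-filter-∷ (_∈? sets (𝓑 j)) A L)))))) ⟩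
      ℚ∑.sum (λ j → q j ℚ.* ι (length (filter (_∈? sets (𝓑 j)) (A ∷ L)))) ∎
      where
      open ≡-Reasoning
      rest : Fin (suc s) → ℕ
      rest j = length (filter (_∈? sets (𝓑 j)) L)

    scale : ∀ j {a b} → a ℕ.≤ b → q j ℚ.* ι a ℚ.≤ q j ℚ.* ι b
    scale j a≤b = ℚ.*-monoˡ-≤-nonNeg (q j) {{ℚ.nonNegative (0≤q j)}} (ι-mono-≤ a≤b)

    -- The hypothesis `prefix-large` says that t is at least d, with denominators cleared. The slack
    -- δ absorbs the error of replacing real weights by terms of their Cauchy sequences.
    module _ (t : ℕ) .{{_ : NonZero t}} (δ : ℚ) (0≤δ : 0ℚ ℚ.≤ δ)
             (prefix-large : ∀ i → ι (suc (toℕ i)) ℚ.* ℚ∑.sum q ℚ.≤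
                                   ι t ℚ.* ℚ∑.sum (prefix (tail q) i) ℚ.+ δ) where

      matching-weight-≤ : ∀ (A : Vector (Subset n) t) → PairwiseDisjoint A →
                          ℚ∑.sum (setWeight ∘ A) ℚ.≤ ι t ℚ.* (ℚ∑.sum (tail q) ℚ.+ δ)
      matching-weight-≤ A dis = begin
        ℚ∑.sum (setWeight ∘ A)                      ≡⟨ sum-setWeight A ⟩
        q zero ℚ.* ι (hits A zero) ℚ.+ U            ≤⟨ bound (∃-few-hits A dis) ⟩
        -- Since t is at least 1, δ may be enlarged to t δ, which gives the bound the form t c
        -- required by `sum-subsets-≤`.
        ι t ℚ.* Q ℚ.+ δ                             ≡⟨ cong (ι t ℚ.* Q ℚ.+_) (ℚ.*-identityˡ δ) ⟨
        ι t ℚ.* Q ℚ.+ ι 1 ℚ.* δ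
          ≤⟨ ℚ.+-monoʳ-≤ (ι t ℚ.* Q) (ℚ.*-monoʳ-≤-nonNeg δ {{ℚ.nonNegative 0≤δ}}
               (ι-mono-≤ {1} {t} (ℕ.>-nonZero⁻¹ t))) ⟩
        ι t ℚ.* Q ℚ.+ ι t ℚ.* δ                     ≡⟨ ℚ.*-distribˡ-+ (ι t) Q δ ⟨
        ι t ℚ.* (Q ℚ.+ δ)                           ∎
        where
        open ℚ.≤-Reasoning
        Q U : ℚ
        Q = ℚ∑.sum (tail q)
        u : Vector ℚ s
        u j = q (suc j) ℚ.* ι (hits A (suc j))
        U = ℚ∑.sum u

        u≤ : ∀ j {b} → hits A (suc j) ℕ.≤ b → u j ℚ.≤ ι b ℚ.* q (suc j)
        u≤ j {b} h = ℚ.≤-trans (scale (suc j) h) (ℚ.≤-reflexive (ℚ.*-comm (q (suc j)) (ι b)))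

        u≤t : ∀ j → u j ℚ.≤ ι t ℚ.* q (suc j)
        u≤t j = u≤ j (count≤ (λ a → member? (suc j) (A a)))

        bound : (∃ λ j → hits A j ℕ.≤ toℕ j) →
                q zero ℚ.* ι (hits A zero) ℚ.+ U ℚ.≤ ι t ℚ.* Q ℚ.+ δ
        -- None of the sets lies in the smallest family, so the term of weight `q zero` vanishes;
        -- each other family contains at most t of them.
        bound (zero , h) = begin
          q zero ℚ.* ι (hits A zero) ℚ.+ U  ≤⟨ ℚ.+-mono-≤ (scale zero h) (sum-mono u≤t) ⟩
          q zero ℚ.* 0ℚ ℚ.+ ℚ∑.sum (λ j → ι t ℚ.* q (suc j))
            ≡⟨ cong₂ ℚ._+_ (ℚ.*-zeroʳ (q zero)) (sym (ℚ∑.*-distribˡ-sum (ι t) (tail q))) ⟩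
          0ℚ ℚ.+ ι t ℚ.* Q                  ≤⟨ ℚ.+-monoˡ-≤ (ι t ℚ.* Q) 0≤δ ⟩
          δ ℚ.+ ι t ℚ.* Q                   ≡⟨ ℚ.+-comm δ (ι t ℚ.* Q) ⟩
          ι t ℚ.* Q ℚ.+ δ                   ∎
        -- By monotonicity all families up to index i + 1, including the smallest, contain at most I
        -- = i + 1 of the sets. W is added and subtracted to fit `two-level-sum`; afterwards I
        -- multiplies the sum of all the weights, and `prefix-large` replaces that product by W + δ.
        bound (suc i , h) = begin
          q zero ℚ.* ι (hits A zero) ℚ.+ U
            ≤⟨ ℚ.+-monoˡ-≤ U (scale zero (ℕ.≤-trans (hits-mono A {zero} {suc i} z≤n) h)) ⟩
          q zero ℚ.* I ℚ.+ U
            ≡⟨ solve 4 (λ a i u w → a :* i :+ u := a :* i :+ (u :+ w) :- w) refl (q zero) I U W ⟩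
          q zero ℚ.* I ℚ.+ (U ℚ.+ W) ℚ.- W
            ≤⟨ ℚ.+-monoˡ-≤ (ℚ.- W) (ℚ.+-monoʳ-≤ (q zero ℚ.* I)
                 (two-level-sum u (tail q) I (ι t) i (0≤ι (suc (toℕ i))) (0≤q ∘ suc)
                   (λ j j≤i → u≤ j (ℕ.≤-trans (hits-mono A {suc j} {suc i} (s≤s j≤i)) h)) u≤t)) ⟩
          q zero ℚ.* I ℚ.+ (I ℚ.* Q ℚ.+ ι t ℚ.* Q) ℚ.- W
            ≡⟨ solve 5 (λ a i q t w → a :* i :+ (i :* q :+ t :* q) :- w
                                    := i :* (a :+ q) :+ (t :* q :- w)) refl (q zero) I Q (ι t) W ⟩
          I ℚ.* (q zero ℚ.+ Q) ℚ.+ (ι t ℚ.* Q ℚ.- W)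
            ≤⟨ ℚ.+-monoˡ-≤ (ι t ℚ.* Q ℚ.- W) (prefix-large i) ⟩
          (W ℚ.+ δ) ℚ.+ (ι t ℚ.* Q ℚ.- W)
            ≡⟨ solve 3 (λ w d x → (w :+ d) :+ (x :- w) := x :+ d) refl W δ (ι t ℚ.* Q) ⟩
          ι t ℚ.* Q ℚ.+ δ ∎
          where
          I W : ℚ
          I = ι (suc (toℕ i))
          W = ι t ℚ.* ℚ∑.sum (prefix (tail q) i)

      chain-weight-≤ : t ℕ.* k ℕ.≤ n →
        ℚ∑.sum (λ j → q j ℚ.* ι (size (𝓑 j))) ℚ.≤ ι (n C k) ℚ.* (ℚ∑.sum (tail q) ℚ.+ δ)
      chain-weight-≤ tk≤n = begin
        ℚ∑.sum (λ j → q j ℚ.* ι (size (𝓑 j)))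
          -- A family lists distinct k-sets, so it is no longer than the part of `subsets n k` lying
          -- in it.
          ≤⟨ sum-mono (λ j → scale j (unique⊆⇒length≤ (unique (𝓑 j)) λ {A} A∈ →
               ∈-filter⁺ (_∈? sets (𝓑 j)) (∈-subsets A (uniform j A∈)) A∈)) ⟩
        ℚ∑.sum (λ j → q j ℚ.* ι (length (filter (_∈? sets (𝓑 j)) (subsets n k))))
          ≡⟨ listSum-setWeight (subsets n k) ⟨
        listSum setWeight (subsets n k)
          ≤⟨ sum-subsets-≤ t k setWeight (ℚ∑.sum (tail q) ℚ.+ δ) tk≤n
               (λ A _ → matching-weight-≤ A) ⟩
        ι (n C k) ℚ.* (ℚ∑.sum (tail q) ℚ.+ δ) ∎
        where open ℚ.≤-Reasoning

-- Passage to real weights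

seq-sum : ∀ {m} (v : Vector ℝ m) i → seq (sum v) i ≡ ℚ∑.sum (λ j → seq (v j) i)
seq-sum {zero}  v i = refl
seq-sum {suc m} v i = cong (seq (v zero) i ℚ.+_) (seq-sum (tail v) i)

seq-≤-maximum : ∀ {m} .{{_ : NonZero m}} (v : Vector ℝ m) i k → seq (v i) k ℚ.≤ seq (maximum v) k
seq-≤-maximum {suc zero}    v zero    k = ℚ.≤-refl
seq-≤-maximum {suc (suc m)} v zero    k = ℚ.p≤p⊔q (seq (v zero) k) (seq (maximum (tail v)) k)
seq-≤-maximum {suc (suc m)} v (suc i) k =
  ℚ.≤-trans (seq-≤-maximum (tail v) i k) (ℚ.p≤q⊔p (seq (v zero) k) (seq (maximum (tail v)) k))

maximum-≤⇒≤ : ∀ {m} .{{_ : NonZero m}} (v : Vector ℝ m) {z} → maximum v ≤ z → ∀ i → v i ≤ z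
maximum-≤⇒≤ v max≤z i ε ε>0 with max≤z ε ε>0
... | N , h = N , λ n N≤n → ℚ.≤-trans (seq-≤-maximum v i n) (h n N≤n)

-- For late terms the truncated denominator yₙ ⊔ c equals yₙ, so multiplying by yₙ undoes the
-- division. With B an eventual bound on the absolute value of yₙ, the tolerance δ is ε / B, so that
-- the error δ yₙ stays below ε.
/-≤⇒≤-* : ∀ x y z (y>0 : 0ℝ < y) → x / y ⟨ y>0 ⟩ ≤ z → x ≤ z * y
/-≤⇒≤-* x y z (c , c>0 , L , c≤y) x/y≤z ε ε>0 = L ℕ.⊔ (M ℕ.⊔ N) , λ n p →
  let q  = ℕ.m⊔n≤o⇒n≤o L (M ℕ.⊔ N) p
      xₙ = seq x n; yₙ = seq y n; zₙ = seq z n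
      c≤yₙ = ℚ.≤-trans (ℚ.≤-reflexive (sym (ℚ.+-identityˡ c))) (c≤y n (ℕ.m⊔n≤o⇒m≤o L (M ℕ.⊔ N) p))
      den>0 = ℚ.<-≤-trans c>0 (ℚ.p≤q⊔p yₙ c)
      i = inv den>0
      open ℚ.≤-Reasoning
  in begin
  xₙ                              ≡⟨ ℚ.*-identityʳ xₙ ⟨
  xₙ ℚ.* 1ℚ                       ≡⟨ cong (xₙ ℚ.*_) (*-inv den>0) ⟨
  xₙ ℚ.* ((yₙ ℚ.⊔ c) ℚ.* i)       ≡⟨ cong (λ w → xₙ ℚ.* (w ℚ.* i)) (ℚ.p≥q⇒p⊔q≡p c≤yₙ) ⟩
  xₙ ℚ.* (yₙ ℚ.* i)               ≡⟨ solve 3 (λ x y i → x :* (y :* i) := (x :* i) :* y) refl xₙ yₙ i ⟩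
  (xₙ ℚ.* i) ℚ.* yₙ
    ≤⟨ ℚ.*-monoʳ-≤-nonNeg yₙ {{ℚ.nonNegative (ℚ.≤-trans (ℚ.<⇒≤ c>0) c≤yₙ)}}
         (x/y≤ n (ℕ.m⊔n≤o⇒n≤o M N q)) ⟩
  (zₙ ℚ.+ δ) ℚ.* yₙ               ≡⟨ ℚ.*-distribʳ-+ yₙ zₙ δ ⟩
  zₙ ℚ.* yₙ ℚ.+ δ ℚ.* yₙ
    ≤⟨ ℚ.+-monoʳ-≤ (zₙ ℚ.* yₙ) (ℚ.*-monoˡ-≤-nonNeg δ {{ℚ.nonNegative (ℚ.<⇒≤ δ>0)}}
         (ℚ.≤-trans (p≤∣p∣ yₙ) (y≤B n (ℕ.m⊔n≤o⇒m≤o M N q)))) ⟩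
  zₙ ℚ.* yₙ ℚ.+ δ ℚ.* B
    ≡⟨ cong (zₙ ℚ.* yₙ ℚ.+_) (trans
         (solve 3 (λ e i b → (e :* i) :* b := e :* (b :* i)) refl ε (inv B>0) B)
         (trans (cong (ε ℚ.*_) (*-inv B>0)) (ℚ.*-identityʳ ε))) ⟩
  zₙ ℚ.* yₙ ℚ.+ ε                 ∎
  where
  B   = proj₁ (bounded y)
  B>0 = proj₁ (proj₂ (bounded y))
  M   = proj₁ (proj₂ (proj₂ (bounded y)))
  y≤B = proj₂ (proj₂ (proj₂ (bounded y)))
  δ   = ε ℚ.* inv B>0
  δ>0 = 0<* ε>0 (inv>0 B>0)
  N   = proj₁ (x/y≤z δ δ>0)
  x/y≤ = proj₂ (x/y≤z δ δ>0)

-- Finitely many thresholds have a common upper bound; this makes the conditions on all the weights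
-- hold at one and the same index.
eventually-all : ∀ {m} {P : Fin m → ℕ → Set} → (∀ i → ∃ λ N → ∀ n → N ℕ.≤ n → P i n) →
                 ∃ λ N → ∀ n → N ℕ.≤ n → ∀ i → P i n
eventually-all {zero}  _ = 0 , λ _ _ ()
eventually-all {suc m} h with h zero | eventually-all (h ∘ suc)
... | M , h₀ | N , hₛ = M ℕ.⊔ N , λ where
  n p zero    → h₀ n (ℕ.m⊔n≤o⇒m≤o M N p)
  n p (suc i) → hₛ n (ℕ.m⊔n≤o⇒n≤o M N p) i

-- A nonpositive c may be replaced by 1, as k ≤ n.
ceiling⇒multiplier : ∀ {x} n k c → x ≤ fromℤ c → c ℤ.* + k ℤ.≤ + n → k ℕ.≤ n →
  ∃ λ t → NonZero t × x ≤ ofℕ t × t ℕ.* k ℕ.≤ n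
ceiling⇒multiplier n k (+ suc t) x≤c ck≤n _ = suc t , _ , x≤c ,
  ℤ.drop‿+≤+ (ℤ.≤-trans (ℤ.≤-reflexive (ℤ.pos-* (suc t) k)) ck≤n)
ceiling⇒multiplier {x} n k (+ 0) x≤c _ k≤n = 1 , _ , (λ ε ε>0 →
  let (N , h) = x≤c ε ε>0 in N , λ m N≤m →
    ℚ.≤-trans (h m N≤m) (ℚ.+-monoˡ-≤ ε (ι-mono-≤ {0} {1} z≤n))) ,
  ℕ.≤-trans (ℕ.≤-reflexive (ℕ.*-identityˡ k)) k≤n
ceiling⇒multiplier {x} n k ℤ.-[1+ j ] x≤c _ k≤n = 1 , _ , (λ ε ε>0 →
  let (N , h) = x≤c ε ε>0 in N , λ m N≤m →
    ℚ.≤-trans (h m N≤m) (ℚ.+-monoˡ-≤ ε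
      (ℚ.≤-trans (ℚ.neg-antimono-≤ (0≤ι (suc j))) (0≤ι 1)))) ,
  ℕ.≤-trans (ℕ.≤-reflexive (ℕ.*-identityˡ k)) k≤n

-- The extremal chain

increasing⇒injective : ∀ {m n} {f : Fin m → Fin n} → (∀ {a b} → a Fin.< b → f a Fin.< f b) →
                       Injective _≡_ _≡_ f
increasing⇒injective f↑ {a} {b} eq with Fin.<-cmp a b
... | tri< a<b _ _ = contradiction eq (Fin.<⇒≢ (f↑ a<b))
... | tri≈ _ a≡b _ = a≡b
... | tri> _ _ b<a = contradiction (sym eq) (Fin.<⇒≢ (f↑ b<a))

∅,all : ∀ n k s → OverlappingChain n k s
∅,all n k s = record
  { 𝓑           = 𝓑
  ; uniform     = λ { zero () ; (suc j) A∈ → subsets-size n k A∈ }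
  ; chain       = λ { {zero} _ () ; {suc i} {suc j} _ A∈ → A∈ }
  -- No member of a matching comes from the empty family, so its indices avoid `zero`. Being
  -- increasing they are distinct, and `punchOut` injects them into the s others.
  ; overlapping = λ r R → let open RainbowMatching R in
      Fin.injective⇒≤ λ {a} {b} eq → increasing⇒injective increasing
        (Fin.punchOut-injective (0≢index R a) (0≢index R b) eq)
  }
  where
  𝓑 : Vector (Family n) (suc s)
  𝓑 zero    = family [] []
  𝓑 (suc j) = family (subsets n k) (subsets-unique n k)

  0≢index : ∀ {r} (R : RainbowMatching 𝓑 r) a → zero ≢ RainbowMatching.index R a
  0≢index R a eq with () ← subst (λ i → RainbowMatching.set R a ∈ sets (𝓑 i)) (sym eq)
                                 (RainbowMatching.member R a)

≡⇒≈ : ∀ {x y} → (∀ m → seq x m ≡ seq y m) → x ≈ y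
≡⇒≈ {x} {y} eq ε ε>0 = 0 , λ m _ → ℚ.≤-trans
  (ℚ.≤-reflexive (cong ℚ.∣_∣ (trans (cong (ℚ._- seq y m) (eq m)) (ℚ.+-inverseʳ (seq y m)))))
  (ℚ.<⇒≤ ε>0)

seq-weight : ∀ {n k s} (p : Vector ℝ (suc s)) (𝒞 : OverlappingChain n k s) m →
  seq (weight p 𝒞) m ≡ ℚ∑.sum (λ j → seq (p j) m ℚ.* ι (size (OverlappingChain.𝓑 𝒞 j)))
seq-weight p 𝒞 m = seq-sum (λ j → p j * ofℕ (size (OverlappingChain.𝓑 𝒞 j))) m

weight-∅,all : ∀ n k s (p : Vector ℝ (suc s)) →
               weight p (∅,all n k s) ≈ sum (tail p) * ofℕ (n C k)
weight-∅,all n k s p = ≡⇒≈ {weight p (∅,all n k s)} {sum (tail p) * ofℕ (n C k)} λ m →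
  trans (seq-weight p (∅,all n k s) m) (trans (ℚ-weight (λ j → seq (p j) m))
    (cong₂ (λ w l → w ℚ.* ι l) (sym (seq-sum (tail p) m)) (length-subsets n k)))
  where
  ℚ-weight : ∀ (q : Vector ℚ (suc s)) →
    ℚ∑.sum (λ j → q j ℚ.* ι (size (OverlappingChain.𝓑 (∅,all n k s) j))) ≡
    ℚ∑.sum (tail q) ℚ.* ι (length (subsets n k))
  ℚ-weight q = begin
    q zero ℚ.* 0ℚ ℚ.+ ℚ∑.sum (λ j → q (suc j) ℚ.* N)
      ≡⟨ cong₂ ℚ._+_ (ℚ.*-zeroʳ (q zero)) (sym (ℚ∑.*-distribʳ-sum N (tail q))) ⟩
    0ℚ ℚ.+ ℚ∑.sum (tail q) ℚ.* N
      ≡⟨ ℚ.+-identityˡ (ℚ∑.sum (tail q) ℚ.* N) ⟩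
    ℚ∑.sum (tail q) ℚ.* N ∎
    where
    open ≡-Reasoning
    N = ι (length (subsets n k))

-- The upper bound for real weights

-- For each late index m the m-th terms of the weights are nonnegative rationals satisfying the
-- prefix inequalities up to δ, so `chain-weight-≤` applies to them.
weight-≤ : ∀ {n k s} (p : Vector ℝ (suc s)) → (∀ j → 0ℝ < p j) →
  ∀ t .{{_ : NonZero t}} → t ℕ.* k ℕ.≤ n →
  (∀ i → ofℕ (suc (toℕ i)) * sum p ≤ ofℕ t * sum (initial p i)) →
  (𝒞 : OverlappingChain n k s) → weight p 𝒞 ≤ sum (tail p) * ofℕ (n C k)
weight-≤ {n} {k} {s} p p>0 t tk≤n prefix-large 𝒞 ε ε>0 = M ℕ.⊔ N , λ m r →
  let open ℚ.≤-Reasoning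
      q : Vector ℚ (suc s)
      q j = seq (p j) m
      Q = ℚ∑.sum (tail q)
  in begin
  seq (weight p 𝒞) m
    ≡⟨ seq-weight p 𝒞 m ⟩
  ℚ∑.sum (λ j → q j ℚ.* ι (size (OverlappingChain.𝓑 𝒞 j)))
    ≤⟨ chain-weight-≤ 𝒞 q (p≥0 m (ℕ.m⊔n≤o⇒m≤o M N r)) t δ (ℚ.<⇒≤ δ>0)
         (prefix-large′ m (ℕ.m⊔n≤o⇒n≤o M N r)) tk≤n ⟩
  ι (n C k) ℚ.* (Q ℚ.+ δ)
    ≡⟨ solve 3 (λ c q d → c :* (q :+ d) := q :* c :+ c :* d) refl (ι (n C k)) Q δ ⟩
  Q ℚ.* ι (n C k) ℚ.+ ι (n C k) ℚ.* δ
    ≤⟨ ℚ.+-monoʳ-≤ (Q ℚ.* ι (n C k)) (ℚ.*-monoʳ-≤-nonNeg δ {{ℚ.nonNegative (ℚ.<⇒≤ δ>0)}}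
         (ι-mono-≤ (ℕ.n≤1+n (n C k)))) ⟩
  Q ℚ.* ι (n C k) ℚ.+ ι (suc (n C k)) ℚ.* δ
    ≡⟨ cong₂ (λ w e → w ℚ.* ι (n C k) ℚ.+ e) (sym (seq-sum (tail p) m)) (trans
         (solve 3 (λ b e i → b :* (e :* i) := e :* (b :* i)) refl (ι (suc (n C k))) ε (inv b>0))
         (trans (cong (ε ℚ.*_) (*-inv b>0)) (ℚ.*-identityʳ ε))) ⟩
  seq (sum (tail p)) m ℚ.* ι (n C k) ℚ.+ ε ∎
  where
  -- δ is ε divided by one more than the binomial coefficient: the divisor is then visibly positive,
  -- and the coefficient times δ is still at most ε.
  b>0 = 0<ι (suc (n C k))
  δ   = ε ℚ.* inv b>0
  δ>0 = 0<* ε>0 (inv>0 b>0)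

  -- A positive real may have negative terms early in its sequence; the witness of positivity bounds
  -- them from below only from some index on.
  p-eventually≥0 : ∃ λ N → ∀ m → N ℕ.≤ m → ∀ j → 0ℚ ℚ.≤ seq (p j) m
  p-eventually≥0 = eventually-all λ j → let (c , c>0 , N , h) = p>0 j in N , λ m N≤m →
    ℚ.≤-trans (ℚ.<⇒≤ c>0) (ℚ.≤-trans (ℚ.≤-reflexive (sym (ℚ.+-identityˡ c))) (h m N≤m))

  eventually-prefix-large : ∃ λ N → ∀ m → N ℕ.≤ m → ∀ i →
    ι (suc (toℕ i)) ℚ.* ℚ∑.sum (λ j → seq (p j) m) ℚ.≤
    ι t ℚ.* ℚ∑.sum (prefix (λ j → seq (p (suc j)) m) i) ℚ.+ δ
  eventually-prefix-large = eventually-all λ i → let (N , h) = prefix-large i δ δ>0 in N , λ m N≤m →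
    let open ℚ.≤-Reasoning in begin
    ι (suc (toℕ i)) ℚ.* ℚ∑.sum (λ j → seq (p j) m)
      ≡⟨ cong (ι (suc (toℕ i)) ℚ.*_) (seq-sum p m) ⟨
    ι (suc (toℕ i)) ℚ.* seq (sum p) m
      ≤⟨ h m N≤m ⟩
    ι t ℚ.* seq (sum (initial p i)) m ℚ.+ δ
      ≡⟨ cong (λ w → ι t ℚ.* w ℚ.+ δ) (seq-sum (initial p i) m) ⟩
    ι t ℚ.* ℚ∑.sum (prefix (λ j → seq (p (suc j)) m) i) ℚ.+ δ ∎

  M = proj₁ p-eventually≥0
  p≥0 = proj₂ p-eventually≥0
  N = proj₁ eventually-prefix-large
  prefix-large′ = proj₂ eventually-prefix-large

maximum-/-≤⇒≤-* : ∀ {m} .{{_ : NonZero m}} (x y : Vector ℝ m) (y>0 : ∀ i → 0ℝ < y i) z →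
  maximum (λ i → x i / y i ⟨ y>0 i ⟩) ≤ z → ∀ i → x i ≤ z * y i
maximum-/-≤⇒≤-* x y y>0 z max≤z i =
  /-≤⇒≤-* (x i) (y i) z (y>0 i) (maximum-≤⇒≤ (λ i → x i / y i ⟨ y>0 i ⟩) {z} max≤z i)

-- For z = `ofℕ t` this yields the inequalities assumed by `weight-≤`.
d≤⇒prefix-large : ∀ {s} .{{_ : NonZero s}} (p : Vector ℝ (suc s)) (p>0 : ∀ j → 0ℝ < p j) z →
  d p p>0 ≤ z → ∀ i → ofℕ (suc (toℕ i)) * sum p ≤ z * sum (initial p i)
d≤⇒prefix-large p p>0 z = maximum-/-≤⇒≤-* (λ i → ofℕ (suc (toℕ i)) * sum p) (λ i → sum (initial p i))
  (λ i → sum-pos (initial p i) (λ j → p>0 (suc (inject≤ j (Fin.toℕ<n i))))) z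

weight-≤-multiplier : ∀ {n k s} .{{_ : NonZero s}} (p : Vector ℝ (suc s)) (p>0 : ∀ j → 0ℝ < p j) →
  (∃ λ t → NonZero t × d p p>0 ≤ ofℕ t × t ℕ.* k ℕ.≤ n) →
  (𝒞 : OverlappingChain n k s) → weight p 𝒞 ≤ sum (tail p) * ofℕ (n C k)
weight-≤-multiplier p p>0 (t , t≢0 , d≤t , tk≤n) =
  weight-≤ p p>0 t {{t≢0}} tk≤n (d≤⇒prefix-large p p>0 (ofℕ t) d≤t)

-- The two halves of the lower bound on n give k ≤ n and c k ≤ n, from which `ceiling⇒multiplier`
-- produces the number t of disjoint sets to average over.
IsCeiling⇒weight-≤ : ∀ n k {s} .{{_ : NonZero s}} (p : Vector ℝ (suc s)) (p>0 : ∀ j → 0ℝ < p j) c →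
  IsCeiling (d p p>0) c → + n ℤ.≥ + (suc s ℕ.* k) ℤ.⊔ (c ℤ.* + k) →
  (𝒞 : OverlappingChain n k s) → weight p 𝒞 ≤ sum (tail p) * ofℕ (n C k)
IsCeiling⇒weight-≤ n k {s} p p>0 c ceil n≥ = weight-≤-multiplier p p>0
  (ceiling⇒multiplier {d p p>0} n k c (proj₁ ceil)
    (ℤ.≤-trans (ℤ.i≤j⊔i (+ (suc s ℕ.* k)) (c ℤ.* + k)) n≥)
    (ℕ.≤-trans (ℕ.m≤n*m k (suc s))
      (ℤ.drop‿+≤+ (ℤ.≤-trans (ℤ.i≤i⊔j (+ (suc s ℕ.* k)) (c ℤ.* + k)) n≥))))

theorem1p6 : (n k s : ℕ) .{{_ : NonZero n}} .{{_ : NonZero k}} .{{_ : NonZero s}}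
    (p : Vector ℝ (suc s)) (p↓ : Antitonic₁ Fin._≤_ _≤_ p) (pₛ>0 : 0ℝ < p (fromℕ s))
    (⌈d⌉ : ℤ) → IsCeiling (d p (weights-pos p p↓ pₛ>0)) ⌈d⌉ →
    + n ℤ.≥ + (suc s ℕ.* k) ℤ.⊔ (⌈d⌉ ℤ.* + k) →
    IsMaximum (weight {n} {k} p) (sum (tail p) * ofℕ (n C k))
theorem1p6 n k s p p↓ pₛ>0 ⌈d⌉ ⌈d⌉-ceil n≥ = record
  { attained   = ∅,all n k s , weight-∅,all n k s p
  ; upperBound = at-weights-pos
      (λ p>0 → IsCeiling (d p p>0) ⌈d⌉ → ∀ 𝒞 → weight {n} {k} p 𝒞 ≤ sum (tail p) * ofℕ (n C k))
      (λ p>0 ceil → IsCeiling⇒weight-≤ n k p p>0 ⌈d⌉ ceil n≥) ⌈d⌉-ceil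
  }
  where
  -- With M a variable, p>0 is instantiated without comparing the Cauchy moduli of
  -- two forms of d p (weights-pos p p↓ pₛ>0).
  at-weights-pos : (M : (∀ j → 0ℝ < p j) → Set) → (∀ p>0 → M p>0) → M (weights-pos p p↓ pₛ>0)
  at-weights-pos M h = h (weights-pos p p↓ pₛ>0)
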